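{- The following problem is undecidable: given a sentence $\varphi$ of the universal fragment of linear arithmetic over the reals with an additional uninterpreted unary predicate symbol $P$, decide whether $\varphi$ is satisfiable. (Equivalently, the corresponding unsatisfiability problem is undecidable.)
   Context: Linear arithmetic over the reals is understood as the set of first-order formulas with equality over the signature $\langle 0,1,+,\le,<\rangle$, interpreted over the domain $\mathbb{R}$ with the standard meaning of all these symbols (here $\le$ and $<$ belong to the signature and are not abbreviations). An integer constant $k\ge1$ stands for $1+\cdots+1$ ($k$ summands) and $kx$ stands for $x+\cdots+x$ ($k$ summands). The universal fragment consists of the sentences in prenex normal form in which only universal quantifiers occur. With an additional uninterpreted unary predicate symbol $P$, an interpretation has domain $\mathbb{R}$, interprets $0,1,+,\le,<$ in the standard way, and interprets $P$ by an arbitrary subset of $\mathbb{R}$. A sentence is satisfiable if some such interpretation satisfies it, and unsatisfiable otherwise. -}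

module Defs where

open import Level using (Level; 0ℓ; _⊔_)
open import Data.Nat as ℕ using (ℕ; zero; suc)
import Data.Nat.Properties as ℕₚ
open import Data.Rational as ℚ using (ℚ; 0ℚ; 1ℚ; ∣_∣)
import Data.Rational.Properties as ℚₚ
open import Data.Fin using (Fin; toℕ)
open import Data.Fin.Properties using (toℕ-injective)
open import Data.Vec using (Vec; []; _∷_; lookup)
open import Data.Product using (Σ; ∃; _×_; _,_; proj₁; proj₂; uncurry)
open import Data.Sum using (_⊎_)
open import Data.Empty using (⊥-elim)
open import Relation.Nullary using (¬_)
open import Relation.Unary using (Pred)
open import Relation.Binary.Definitions using (_Respects_)
open import Relation.Binary.PropositionalEquality

open import Algebra.Properties.AbelianGroup ℚₚ.+-0-abelianGroup using (xyx⁻¹≈y)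
open import Algebra.Bundles using (module CommutativeMonoid)
open import Algebra.Properties.CommutativeSemigroup
  (CommutativeMonoid.commutativeSemigroup ℚₚ.+-0-commutativeMonoid)
  using (interchange)

private
  variable
    a p : Level
    m n : ℕ

------------------------------------------------------------------------
-- The real numbers: Cauchy sequences of rationals, with _≃ℝ_ as the
-- equality.

record ℝ : Set where
  field
    seq    : ℕ → ℚ
    cauchy : ∀ ε → 0ℚ ℚ.< ε → ∃ λ N → ∀ m n → N ℕ.≤ m → N ℕ.≤ n →
             ∣ seq m ℚ.- seq n ∣ ℚ.< ε

open ℝ public

infix  4 _≃ℝ_ _≤ℝ_ _<ℝ_
infixl 6 _+ℝ_

_≃ℝ_ : ℝ → ℝ → Set
x ≃ℝ y = ∀ ε → 0ℚ ℚ.< ε → ∃ λ N → ∀ n → N ℕ.≤ n → ∣ seq x n ℚ.- seq y n ∣ ℚ.< ε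

_≤ℝ_ : ℝ → ℝ → Set
x ≤ℝ y = ∀ ε → 0ℚ ℚ.< ε → ∃ λ N → ∀ n → N ℕ.≤ n → seq x n ℚ.≤ seq y n ℚ.+ ε

_<ℝ_ : ℝ → ℝ → Set
x <ℝ y = ∃ λ ε → 0ℚ ℚ.< ε × ∃ λ N → ∀ n → N ℕ.≤ n → seq x n ℚ.+ ε ℚ.≤ seq y n

fromℚ : ℚ → ℝ
fromℚ q .seq _ = q
fromℚ q .cauchy ε 0<ε =
  0 , λ _ _ _ _ → subst (ℚ._< ε) (cong ∣_∣ (sym (ℚₚ.+-inverseʳ q))) 0<ε

0ℝ 1ℝ : ℝ
0ℝ = fromℚ 0ℚ
1ℝ = fromℚ 1ℚ

_+ℝ_ : ℝ → ℝ → ℝ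
(x +ℝ y) .seq n = seq x n ℚ.+ seq y n
(x +ℝ y) .cauchy ε 0<ε with ℚₚ.<-dense 0<ε
... | δ , 0<δ , δ<ε
  with cauchy x δ 0<δ
     | cauchy y (ε ℚ.- δ) (subst (ℚ._< ε ℚ.- δ) (ℚₚ.+-inverseʳ δ) (ℚₚ.+-monoˡ-< (ℚ.- δ) δ<ε))
... | Nx , x-close | Ny , y-close = Nx ℕ.⊔ Ny , close
  where
  rearrange : ∀ a b c d → (a ℚ.+ b) ℚ.- (c ℚ.+ d) ≡ (a ℚ.- c) ℚ.+ (b ℚ.- d)
  rearrange a b c d =
    trans (cong ((a ℚ.+ b) ℚ.+_) (ℚₚ.neg-distrib-+ c d)) (interchange a b (ℚ.- c) (ℚ.- d))

  close : ∀ m n → Nx ℕ.⊔ Ny ℕ.≤ m → Nx ℕ.⊔ Ny ℕ.≤ n →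
          ∣ (seq x m ℚ.+ seq y m) ℚ.- (seq x n ℚ.+ seq y n) ∣ ℚ.< ε
  close m n N≤m N≤n = begin-strict
    ∣ (seq x m ℚ.+ seq y m) ℚ.- (seq x n ℚ.+ seq y n) ∣
      ≡⟨ cong ∣_∣ (rearrange (seq x m) (seq y m) (seq x n) (seq y n)) ⟩
    ∣ (seq x m ℚ.- seq x n) ℚ.+ (seq y m ℚ.- seq y n) ∣
      ≤⟨ ℚₚ.∣p+q∣≤∣p∣+∣q∣ (seq x m ℚ.- seq x n) (seq y m ℚ.- seq y n) ⟩
    ∣ seq x m ℚ.- seq x n ∣ ℚ.+ ∣ seq y m ℚ.- seq y n ∣
      <⟨ ℚₚ.+-mono-<
           (x-close m n (ℕₚ.m⊔n≤o⇒m≤o Nx Ny N≤m) (ℕₚ.m⊔n≤o⇒m≤o Nx Ny N≤n))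
           (y-close m n (ℕₚ.m⊔n≤o⇒n≤o Nx Ny N≤m) (ℕₚ.m⊔n≤o⇒n≤o Nx Ny N≤n)) ⟩
    δ ℚ.+ (ε ℚ.- δ)
      ≡⟨ sym (ℚₚ.+-assoc δ ε (ℚ.- δ)) ⟩
    δ ℚ.+ ε ℚ.- δ
      ≡⟨ xyx⁻¹≈y δ ε ⟩
    ε ∎
    where open ℚₚ.≤-Reasoning

------------------------------------------------------------------------
-- Linear arithmetic with one unary predicate symbol P.  Variables are
-- de Bruijn indices.

infixl 6 _⊕_
infix  4 _≐_ _⩽_ _⋖_
infix  3 ∼_
infixr 2 _∧_
infixr 1 _∨_
infixr 0 _⇒_

data Term (n : ℕ) : Set where
  var : Fin n → Term n
  𝟎 𝟏 : Term n
  _⊕_ : Term n → Term n → Term n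

data QuantifierFree (n : ℕ) : Set where
  _≐_ _⩽_ _⋖_ : Term n → Term n → QuantifierFree n
  P[_]        : Term n → QuantifierFree n
  ∼_          : QuantifierFree n → QuantifierFree n
  _∧_ _∨_ _⇒_ : QuantifierFree n → QuantifierFree n → QuantifierFree n

data Universal (n : ℕ) : Set where
  matrix  : QuantifierFree n → Universal n
  forall′ : Universal (suc n) → Universal n

UniversalSentence : Set
UniversalSentence = Universal 0

-- The domain and the symbols 0, 1, +, ≤, < and = are fixed, so an
-- interpretation amounts to a subset of ℝ.

record Interpretation : Set₁ where
  field
    P          : Pred ℝ 0ℓ
    P-respects : P Respects _≃ℝ_

⟦_⟧ : Term n → Vec ℝ n → ℝ
⟦ var i ⟧ ρ = lookup ρ i
⟦ 𝟎 ⟧     ρ = 0ℝ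
⟦ 𝟏 ⟧     ρ = 1ℝ
⟦ s ⊕ t ⟧ ρ = ⟦ s ⟧ ρ +ℝ ⟦ t ⟧ ρ

module _ (I : Interpretation) where
  open Interpretation I

  HoldsQF : QuantifierFree n → Vec ℝ n → Set
  HoldsQF (s ≐ t)  ρ = ⟦ s ⟧ ρ ≃ℝ ⟦ t ⟧ ρ
  HoldsQF (s ⩽ t)  ρ = ⟦ s ⟧ ρ ≤ℝ ⟦ t ⟧ ρ
  HoldsQF (s ⋖ t)  ρ = ⟦ s ⟧ ρ <ℝ ⟦ t ⟧ ρ
  HoldsQF P[ t ]   ρ = P (⟦ t ⟧ ρ)
  HoldsQF (∼ φ)    ρ = ¬ HoldsQF φ ρ
  HoldsQF (φ ∧ ψ)  ρ = HoldsQF φ ρ × HoldsQF ψ ρ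
  HoldsQF (φ ∨ ψ)  ρ = HoldsQF φ ρ ⊎ HoldsQF ψ ρ
  HoldsQF (φ ⇒ ψ)  ρ = HoldsQF φ ρ → HoldsQF ψ ρ

  Holds : Universal n → Vec ℝ n → Set
  Holds (matrix φ)  ρ = HoldsQF φ ρ
  Holds (forall′ φ) ρ = ∀ x → Holds φ (x ∷ ρ)

Satisfiable : UniversalSentence → Set₁
Satisfiable φ = Σ Interpretation λ I → Holds I φ []

Unsatisfiable : UniversalSentence → Set₁
Unsatisfiable φ = ¬ Satisfiable φ

------------------------------------------------------------------------
-- Gödel numbering: a constructor tag paired with the code of the
-- arguments.

⟨_,_⟩ : ℕ → ℕ → ℕ
⟨ a , b ⟩ = 2 ℕ.^ a ℕ.* suc (2 ℕ.* b)

nodeTerm : Term n → ℕ × ℕ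
codeTerm : Term n → ℕ
codeTerm t = uncurry ⟨_,_⟩ (nodeTerm t)
nodeTerm (var i) = 0 , toℕ i
nodeTerm 𝟎       = 1 , 0
nodeTerm 𝟏       = 2 , 0
nodeTerm (s ⊕ t) = 3 , ⟨ codeTerm s , codeTerm t ⟩

nodeQF : QuantifierFree n → ℕ × ℕ
codeQF : QuantifierFree n → ℕ
codeQF φ = uncurry ⟨_,_⟩ (nodeQF φ)
nodeQF (s ≐ t) = 0 , ⟨ codeTerm s , codeTerm t ⟩
nodeQF (s ⩽ t) = 1 , ⟨ codeTerm s , codeTerm t ⟩
nodeQF (s ⋖ t) = 2 , ⟨ codeTerm s , codeTerm t ⟩
nodeQF P[ t ]  = 3 , codeTerm t
nodeQF (∼ φ)   = 4 , codeQF φ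
nodeQF (φ ∧ ψ) = 5 , ⟨ codeQF φ , codeQF ψ ⟩
nodeQF (φ ∨ ψ) = 6 , ⟨ codeQF φ , codeQF ψ ⟩
nodeQF (φ ⇒ ψ) = 7 , ⟨ codeQF φ , codeQF ψ ⟩

code : Universal n → ℕ
code (matrix φ)  = ⟨ 0 , codeQF φ ⟩
code (forall′ φ) = ⟨ 1 , code φ ⟩

⟨,⟩-injective : ∀ a b c d → ⟨ a , b ⟩ ≡ ⟨ c , d ⟩ → a ≡ c × b ≡ d
⟨,⟩-injective zero b zero d eq = refl ,
  ℕₚ.*-cancelˡ-≡ b d 2 (ℕₚ.suc-injective
    (trans (sym (ℕₚ.*-identityˡ (suc (2 ℕ.* b)))) (trans eq (ℕₚ.*-identityˡ (suc (2 ℕ.* d))))))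
⟨,⟩-injective zero b (suc c) d eq = ⊥-elim (ℕₚ.even≢odd ⟨ c , d ⟩ b
  (trans (sym (ℕₚ.*-assoc 2 (2 ℕ.^ c) _)) (trans (sym eq) (ℕₚ.*-identityˡ _))))
⟨,⟩-injective (suc a) b zero d eq = ⊥-elim (ℕₚ.even≢odd ⟨ a , b ⟩ d
  (trans (sym (ℕₚ.*-assoc 2 (2 ℕ.^ a) _)) (trans eq (ℕₚ.*-identityˡ _))))
⟨,⟩-injective (suc a) b (suc c) d eq
  with ⟨,⟩-injective a b c d (ℕₚ.*-cancelˡ-≡ ⟨ a , b ⟩ ⟨ c , d ⟩ 2
    (trans (sym (ℕₚ.*-assoc 2 (2 ℕ.^ a) _)) (trans eq (ℕₚ.*-assoc 2 (2 ℕ.^ c) _))))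
... | refl , b≡d = refl , b≡d

private
  unpair : ∀ {a b c d} → ⟨ a , b ⟩ ≡ ⟨ c , d ⟩ → a ≡ c × b ≡ d
  unpair {a} {b} {c} {d} = ⟨,⟩-injective a b c d

  unnode : (x y : ℕ × ℕ) → uncurry ⟨_,_⟩ x ≡ uncurry ⟨_,_⟩ y → x ≡ y
  unnode (a , b) (c , d) eq with ⟨,⟩-injective a b c d eq
  ... | refl , refl = refl

nodeTerm-injective : (s t : Term n) → nodeTerm s ≡ nodeTerm t → s ≡ t
codeTerm-injective : (s t : Term n) → codeTerm s ≡ codeTerm t → s ≡ t
codeTerm-injective s t eq = nodeTerm-injective s t (unnode (nodeTerm s) (nodeTerm t) eq)
nodeTerm-injective (var i) (var j) eq = cong var (toℕ-injective (cong proj₂ eq))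
nodeTerm-injective 𝟎 𝟎 eq = refl
nodeTerm-injective 𝟏 𝟏 eq = refl
nodeTerm-injective (s ⊕ t) (s′ ⊕ t′) eq with unpair (cong proj₂ eq)
... | e , e′ = cong₂ _⊕_ (codeTerm-injective s s′ e) (codeTerm-injective t t′ e′)

private
  codeTerm² : ∀ (s t s′ t′ : Term n) →
              ⟨ codeTerm s , codeTerm t ⟩ ≡ ⟨ codeTerm s′ , codeTerm t′ ⟩ → s ≡ s′ × t ≡ t′
  codeTerm² s t s′ t′ eq with unpair eq
  ... | e , e′ = codeTerm-injective s s′ e , codeTerm-injective t t′ e′

nodeQF-injective : (φ ψ : QuantifierFree n) → nodeQF φ ≡ nodeQF ψ → φ ≡ ψ
codeQF-injective : (φ ψ : QuantifierFree n) → codeQF φ ≡ codeQF ψ → φ ≡ ψ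
codeQF-injective φ ψ eq = nodeQF-injective φ ψ (unnode (nodeQF φ) (nodeQF ψ) eq)
nodeQF-injective (s ≐ t) (s′ ≐ t′) eq = uncurry (cong₂ _≐_) (codeTerm² s t s′ t′ (cong proj₂ eq))
nodeQF-injective (s ⩽ t) (s′ ⩽ t′) eq = uncurry (cong₂ _⩽_) (codeTerm² s t s′ t′ (cong proj₂ eq))
nodeQF-injective (s ⋖ t) (s′ ⋖ t′) eq = uncurry (cong₂ _⋖_) (codeTerm² s t s′ t′ (cong proj₂ eq))
nodeQF-injective P[ t ] P[ t′ ] eq = cong P[_] (codeTerm-injective t t′ (cong proj₂ eq))
nodeQF-injective (∼ φ) (∼ φ′) eq = cong ∼_ (codeQF-injective φ φ′ (cong proj₂ eq))
nodeQF-injective (φ ∧ ψ) (φ′ ∧ ψ′) eq with unpair (cong proj₂ eq)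
... | e , e′ = cong₂ _∧_ (codeQF-injective φ φ′ e) (codeQF-injective ψ ψ′ e′)
nodeQF-injective (φ ∨ ψ) (φ′ ∨ ψ′) eq with unpair (cong proj₂ eq)
... | e , e′ = cong₂ _∨_ (codeQF-injective φ φ′ e) (codeQF-injective ψ ψ′ e′)
nodeQF-injective (φ ⇒ ψ) (φ′ ⇒ ψ′) eq with unpair (cong proj₂ eq)
... | e , e′ = cong₂ _⇒_ (codeQF-injective φ φ′ e) (codeQF-injective ψ ψ′ e′)

code-injective : (φ ψ : Universal n) → code φ ≡ code ψ → φ ≡ ψ
code-injective (matrix φ) (matrix ψ) eq =
  cong matrix (codeQF-injective φ ψ (proj₂ (⟨,⟩-injective 0 (codeQF φ) 0 (codeQF ψ) eq)))
code-injective (forall′ φ) (forall′ ψ) eq =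
  cong forall′ (code-injective φ ψ (proj₂ (⟨,⟩-injective 1 (code φ) 1 (code ψ) eq)))
code-injective (matrix φ) (forall′ ψ) eq
  with () ← proj₁ (⟨,⟩-injective 0 (codeQF φ) 1 (code ψ) eq)
code-injective (forall′ φ) (matrix ψ) eq
  with () ← proj₁ (⟨,⟩-injective 1 (code φ) 0 (codeQF ψ) eq)

------------------------------------------------------------------------
-- Partial recursive functions (Kleene) and recursive decidability.

data Recursive : ℕ → Set where
  zeroF : Recursive n
  sucF  : Recursive 1
  proj  : Fin n → Recursive n
  comp  : Recursive m → Vec (Recursive n) m → Recursive n
  prec  : Recursive n → Recursive (suc (suc n)) → Recursive (suc n)
  μ     : Recursive (suc n) → Recursive n

infix 4 _[_]↦_ _[_]↦*_

-- f [ xs ]↦ y: the partial function f is defined at xs with value y.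

data _[_]↦_ : Recursive n → Vec ℕ n → ℕ → Set
data _[_]↦*_ : Vec (Recursive n) m → Vec ℕ n → Vec ℕ m → Set

data _[_]↦_ where
  zero-↦ : {xs : Vec ℕ n} → zeroF [ xs ]↦ 0
  suc-↦  : ∀ {x} → sucF [ x ∷ [] ]↦ suc x
  proj-↦ : {i : Fin n} {xs : Vec ℕ n} → proj i [ xs ]↦ lookup xs i
  comp-↦ : {f : Recursive m} {gs : Vec (Recursive n) m} {xs : Vec ℕ n} {ys : Vec ℕ m} {z : ℕ} →
           gs [ xs ]↦* ys → f [ ys ]↦ z → comp f gs [ xs ]↦ z
  prec-zero-↦ : {f : Recursive n} {g : Recursive (suc (suc n))} {xs : Vec ℕ n} {z : ℕ} →
           f [ xs ]↦ z → prec f g [ 0 ∷ xs ]↦ z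
  prec-suc-↦ : {f : Recursive n} {g : Recursive (suc (suc n))} {xs : Vec ℕ n} {k y z : ℕ} →
           prec f g [ k ∷ xs ]↦ y → g [ k ∷ y ∷ xs ]↦ z → prec f g [ suc k ∷ xs ]↦ z
  μ-↦    : {f : Recursive (suc n)} {xs : Vec ℕ n} {y : ℕ} →
           f [ y ∷ xs ]↦ 0 → (∀ k → k ℕ.< y → ∃ λ v → f [ k ∷ xs ]↦ suc v) → μ f [ xs ]↦ y

data _[_]↦*_ where
  []  : {xs : Vec ℕ n} → [] [ xs ]↦* []
  _∷_ : {g : Recursive n} {gs : Vec (Recursive n) m} {xs : Vec ℕ n} {y : ℕ} {ys : Vec ℕ m} →
        g [ xs ]↦ y → gs [ xs ]↦* ys → (g ∷ gs) [ xs ]↦* (y ∷ ys)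

-- Decidability of the problem Q, whose instances are given by their
-- codes.  Nothing is required at numbers that code no instance.

RecursivelyDecidable : {A : Set a} → (A → ℕ) → (A → Set p) → Set (a ⊔ p)
RecursivelyDecidable ⌜_⌝ Q = Σ (Recursive 1) λ f → ∀ x →
  (f [ ⌜ x ⌝ ∷ [] ]↦ 1 × Q x) ⊎ (f [ ⌜ x ⌝ ∷ [] ]↦ 0 × ¬ Q x)

Undecidable : {A : Set a} → (A → ℕ) → (A → Set p) → Set (a ⊔ p)
Undecidable ⌜_⌝ Q = ¬ RecursivelyDecidable ⌜_⌝ Q

{-# OPTIONS --safe #-}
-- Horn clauses with the single predicate P can run programs.  Put pair a b = 2 ^ (a + b) + b.
-- Its graph is given by linear atoms over the unary predicates {2 ^ e} and {2 ^ e + e}, which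
-- are themselves generated by Horn clauses.  Hence, coding a judgement "program F maps X to y"
-- by one number, the rules of a big-step evaluator of recursive functions are finitely many
-- universal Horn clauses over unary predicates, and these are packed into P by residues.  In
-- every model all true judgements hold, and the true judgements alone form a model.  So the
-- sentence φ b e, the rules together with "program e does not return b on e", is satisfiable
-- iff e does not return b on e.  The code of φ b e is a computable function of e; composing
-- it with a decision procedure gives a program e that refutes the procedure at φ b e.
module Submission where

open import Defs
open import Data.Empty using (⊥; ⊥-elim)
open import Data.Fin using (Fin; zero; suc; _↑ˡ_; _↑ʳ_; splitAt; inject≤; #_)
open import Data.Fin.Properties using (splitAt-↑ˡ; splitAt-↑ʳ)
open import Data.List as List using (List; []; _∷_)
open import Data.List.Membership.Propositional.Properties using (∈-lookup)
open import Data.List.Relation.Unary.All as All using (All; []; _∷_)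
open import Data.Nat
  using (ℕ; zero; suc; _+_; _*_; _^_; _∸_; _⊔_; _≤_; _<_; z≤n; s≤s; _≤?_; _<?_)
open import Data.Nat.Properties
open import Data.Nat.Tactic.RingSolver using (solve-∀)
open import Data.Product using (Σ; ∃; ∃₂; _×_; _,_; proj₁; proj₂; uncurry)
open import Data.Rational as ℚ using (ℚ; 0ℚ; 1ℚ; ∣_∣)
import Data.Rational.Properties as ℚₚ
open import Data.Sum using (inj₁; inj₂; [_,_]′)
open import Data.Unit using (⊤; tt)
open import Data.Vec using (Vec; []; _∷_; lookup; tabulate)
open import Data.Vec.Properties using (lookup∘tabulate)
open import Function using (_∘_; _⇔_; mk⇔; Equivalence)
open import Relation.Binary.Definitions using (tri<; tri≈; tri>)
open import Relation.Binary.PropositionalEquality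
open import Relation.Nullary using (¬_; yes; no)
open import Relation.Nullary.Decidable using (True; toWitness)

open import Algebra.Properties.AbelianGroup ℚₚ.+-0-abelianGroup
  using (xyx⁻¹≈y; x∙y⁻¹≈ε⇒x≈y; ⁻¹-anti-homo-//; ∙-cancelˡ)
open import Algebra.Bundles using (module CommutativeMonoid)
open import Algebra.Properties.CommutativeSemigroup
  (CommutativeMonoid.commutativeSemigroup ℚₚ.+-0-commutativeMonoid)
  using (interchange)

open Equivalence using (to; from)

private
  variable
    m n k : ℕ

-- Pairing

n<2^n : ∀ n → n < 2 ^ n
n<2^n zero    = s≤s z≤n
n<2^n (suc n) = begin-strict
  suc n               ≤⟨ n<2^n n ⟩
  2 ^ n               <⟨ m<m+n (2 ^ n) (m^n>0 2 n) ⟩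
  2 ^ n + 2 ^ n       ≡⟨ cong (2 ^ n +_) (+-identityʳ (2 ^ n)) ⟨
  2 ^ suc n           ∎
  where open ≤-Reasoning

double-2^ : m < n → 2 ^ m + 2 ^ m ≤ 2 ^ n
double-2^ {m} {n} m<n = begin
  2 ^ m + 2 ^ m       ≡⟨ cong (2 ^ m +_) (+-identityʳ (2 ^ m)) ⟨
  2 ^ suc m           ≤⟨ ^-monoʳ-≤ 2 m<n ⟩
  2 ^ n               ∎
  where open ≤-Reasoning

2^m+b<2^n : ∀ {b} → m < n → b ≤ m → 2 ^ m + b < 2 ^ n
2^m+b<2^n {m} {n} m<n b≤m =
  <-≤-trans (+-monoʳ-< (2 ^ m) (≤-<-trans b≤m (n<2^n m))) (double-2^ m<n)

-- The gap between the exponent `a + b` and its power of 2. By `n<2^n` the truncated subtraction is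
-- exact, so the power is a sum of natural numbers, as a linear term requires.
slack : ℕ → ℕ → ℕ
slack a b = 2 ^ (a + b) ∸ (a + b)

slack-2^ : ∀ a b → slack a b + (a + b) ≡ 2 ^ (a + b)
slack-2^ a b = m∸n+n≡m (<⇒≤ (n<2^n (a + b)))

-- Opaque so that nested codes never unfold into huge powers; outside, `slack-pair` and injectivity
-- are all that is visible.
opaque
  pair : ℕ → ℕ → ℕ
  pair a b = 2 ^ (a + b) + b

  slack-pair : ∀ a b → slack a b + (a + b) + b ≡ pair a b
  slack-pair a b = cong (_+ b) (slack-2^ a b)

  -- Since `b ≤ a + b < 2 ^ (a + b)`, the value lies in the interval from `2 ^ (a + b)` up to the
  -- next power. Its size therefore fixes `a + b`, the remainder fixes `b`, and `a` follows.
  pair-injective : ∀ {a b c d} → pair a b ≡ pair c d → a ≡ c × b ≡ d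
  pair-injective {a} {b} {c} {d} eq with <-cmp (a + b) (c + d)
  ... | tri< lt _ _ =
    ⊥-elim (<⇒≢ (<-≤-trans (2^m+b<2^n lt (m≤n+m b a)) (m≤m+n (2 ^ (c + d)) d)) eq)
  ... | tri> _ _ gt =
    ⊥-elim (<⇒≢ (<-≤-trans (2^m+b<2^n gt (m≤n+m d c)) (m≤m+n (2 ^ (a + b)) b)) (sym eq))
  ... | tri≈ _ e _ = +-cancelʳ-≡ b a c (trans e (cong (c +_) (sym b≡d))) , b≡d
    where
    b≡d : b ≡ d
    b≡d = +-cancelˡ-≡ (2 ^ (a + b)) b d (trans eq (cong (λ s → 2 ^ s + d) (sym e)))

-- The numbers 2 ^ m and 2 ^ m + s determine s among the sums 2 ^ n + n, which is what makes
-- the relation "s is the exponent of t" expressible by two unary predicates.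
exponent-unique : ∀ {s} → s ≤ 2 ^ m → 2 ^ m + s ≡ 2 ^ n + n → s ≡ m
exponent-unique {m} {n} {s} s≤2^m eq with <-cmp m n
... | tri< m<n _ _ = ⊥-elim (<⇒≢ (begin-strict
  2 ^ m + s     ≤⟨ +-monoʳ-≤ (2 ^ m) s≤2^m ⟩
  2 ^ m + 2 ^ m ≤⟨ double-2^ m<n ⟩
  2 ^ n         <⟨ m<m+n (2 ^ n) (≤-<-trans z≤n m<n) ⟩
  2 ^ n + n     ∎) eq)
  where open ≤-Reasoning
... | tri≈ _ refl _ = +-cancelˡ-≡ (2 ^ m) s m eq
... | tri> _ _ n<m =
  ⊥-elim (<⇒≢ (<-≤-trans (2^m+b<2^n n<m ≤-refl) (m≤m+n (2 ^ m) s)) (sym eq))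

-- The exponents in the two hypotheses are not assumed equal. The first bounds `a + b` by its power
-- of 2, and then `exponent-unique` identifies `a + b` with the exponent of that power.
slack-unique : ∀ {d} a b → (∃ λ e → d + (a + b) ≡ 2 ^ e) →
               (∃ λ e → d + (a + b) + (a + b) ≡ 2 ^ e + e) → d ≡ slack a b
slack-unique {d} a b (m , eq) (n , eq′) = begin
  d                         ≡⟨ m+n∸n≡m d (a + b) ⟨
  d + (a + b) ∸ (a + b)     ≡⟨ cong (_∸ (a + b)) eq ⟩
  2 ^ m ∸ (a + b)           ≡⟨ cong (λ e → 2 ^ e ∸ (a + b)) a+b≡m ⟨
  slack a b                 ∎
  where
  open ≡-Reasoning
  a+b≡m : a + b ≡ m
  a+b≡m = exponent-unique {m} {n} (subst (a + b ≤_) eq (m≤n+m (a + b) d))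
    (trans (cong (_+ (a + b)) (sym eq)) eq′)

-- Evaluation of programs given by numbers

-- Eval t a X y: the program with tag t and parameter a maps the coded tuple X to y.
-- Tag 0 serves both as the constant 0 and as the empty list of functions (the empty tuple
-- is coded by 0); tags 2 and 3 build projections, and tag 7 searches upwards from the first
-- entry of X for a zero.  Being literals, the tags make the rules invertible by matching.
mutual
  data Eval : ℕ → ℕ → ℕ → ℕ → Set where
    zero : ∀ {a X} → Eval 0 a X 0
    succ : ∀ {a X x} → X ≡ pair x 0 → Eval 1 a X (suc x)
    head : ∀ {a X x X′} → X ≡ pair x X′ → Eval 2 a X x
    tail : ∀ {a X x X′ y} → X ≡ pair x X′ → a ⊢ X′ ⇓ y → Eval 3 a X y
    comp : ∀ {a X F G Y z} → a ≡ pair F G → G ⊢ X ⇓ Y → F ⊢ Y ⇓ z → Eval 4 a X z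
    cons : ∀ {a X F G y Y} → a ≡ pair F G → F ⊢ X ⇓ y → G ⊢ X ⇓ Y → Eval 5 a X (pair y Y)
    prec-zero : ∀ {a X F G X′ z} → a ≡ pair F G → X ≡ pair 0 X′ →
                F ⊢ X′ ⇓ z → Eval 6 a X z
    prec-suc  : ∀ {a X F G k X′ y z} → a ≡ pair F G → X ≡ pair (suc k) X′ →
                Eval 6 a (pair k X′) y → G ⊢ pair k (pair y X′) ⇓ z → Eval 6 a X z
    found : ∀ {a X k X′} → X ≡ pair k X′ → a ⊢ X ⇓ 0 → Eval 7 a X k
    next  : ∀ {a X k X′ v y} → X ≡ pair k X′ → a ⊢ X ⇓ suc v →
            Eval 7 a (pair (suc k) X′) y → Eval 7 a X y
    search : ∀ {a X y} → Eval 7 a (pair 0 X) y → Eval 8 a X y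

  _⊢_⇓_ : ℕ → ℕ → ℕ → Set
  F ⊢ X ⇓ y = ∃₂ λ t a → F ≡ pair t a × Eval t a X y

infix 4 _⊢_⇓_

mutual
  -- The tag decides the constructor except for tags 6 and 7; there the first entry of `X`,
  -- respectively the value of the tested function, is zero in one case and a successor in the
  -- other. The diagonal argument uses this to exclude every output but the actual one.
  Eval-functional : ∀ {t a X y z} → Eval t a X y → Eval t a X z → y ≡ z
  Eval-functional zero zero = refl
  Eval-functional (succ e) (succ e′) = cong suc (proj₁ (pair-injective (trans (sym e) e′)))
  Eval-functional (head e) (head e′) = proj₁ (pair-injective (trans (sym e) e′))
  Eval-functional (tail e p) (tail e′ p′) with refl ← proj₂ (pair-injective (trans (sym e) e′)) =
    ⇓-functional p p′
  Eval-functional (comp e p q) (comp e′ p′ q′)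
    with refl , refl ← pair-injective (trans (sym e) e′)
    with refl ← ⇓-functional p p′ = ⇓-functional q q′
  Eval-functional (cons e p q) (cons e′ p′ q′)
    with refl , refl ← pair-injective (trans (sym e) e′) =
    cong₂ pair (⇓-functional p p′) (⇓-functional q q′)
  Eval-functional (prec-zero e f p) (prec-zero e′ f′ p′)
    with refl , refl ← pair-injective (trans (sym e) e′)
    with refl ← proj₂ (pair-injective (trans (sym f) f′)) = ⇓-functional p p′
  Eval-functional (prec-zero e f p) (prec-suc e′ f′ p′ q′)
    with () ← proj₁ (pair-injective (trans (sym f) f′))
  Eval-functional (prec-suc e f p q) (prec-zero e′ f′ p′)
    with () ← proj₁ (pair-injective (trans (sym f) f′))
  Eval-functional (prec-suc e f p q) (prec-suc e′ f′ p′ q′)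
    with refl , refl ← pair-injective (trans (sym e) e′)
    with refl , refl ← pair-injective (trans (sym f) f′)
    with refl ← Eval-functional p p′ = ⇓-functional q q′
  Eval-functional (found e p) (found e′ p′) = proj₁ (pair-injective (trans (sym e) e′))
  Eval-functional (found e p) (next e′ p′ q′) with () ← ⇓-functional p p′
  Eval-functional (next e p q) (found e′ p′) with () ← ⇓-functional p p′
  Eval-functional (next e p q) (next e′ p′ q′)
    with refl , refl ← pair-injective (trans (sym e) e′) = Eval-functional q q′
  Eval-functional (search p) (search p′) = Eval-functional p p′

  ⇓-functional : ∀ {F X y z} → F ⊢ X ⇓ y → F ⊢ X ⇓ z → y ≡ z
  ⇓-functional (t , a , e , p) (t′ , a′ , e′ , p′)
    with refl , refl ← pair-injective (trans (sym e) e′) = Eval-functional p p′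

-- Numbers of recursive functions.

projIndex : Fin n → ℕ
projIndex zero    = pair 2 0
projIndex (suc i) = pair 3 (projIndex i)

mutual
  index : Recursive n → ℕ
  index zeroF       = pair 0 0
  index sucF        = pair 1 0
  index (proj i)    = projIndex i
  index (comp f gs) = pair 4 (pair (index f) (index* gs))
  index (prec f g)  = pair 6 (pair (index f) (index g))
  index (μ f)       = pair 8 (index f)

  index* : Vec (Recursive n) m → ℕ
  index* []       = pair 0 0
  index* (g ∷ gs) = pair 5 (pair (index g) (index* gs))

tuple : Vec ℕ n → ℕ
tuple []       = 0
tuple (x ∷ xs) = pair x (tuple xs)

projIndex-⇓ : (i : Fin n) (xs : Vec ℕ n) → projIndex i ⊢ tuple xs ⇓ lookup xs i
projIndex-⇓ zero    (x ∷ xs) = _ , _ , refl , head refl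
projIndex-⇓ (suc i) (x ∷ xs) = _ , _ , refl , tail refl (projIndex-⇓ i xs)

-- Induction on the number `j` of failing tests still ahead when the search stands at `k`; each
-- `next` moves one unit from `j` to `k`.
search-from : ∀ {F X} j k → F ⊢ pair (j + k) X ⇓ 0 →
              (∀ i → i < j + k → ∃ λ v → F ⊢ pair i X ⇓ suc v) →
              Eval 7 F (pair k X) (j + k)
search-from zero    k stop pos = found refl stop
search-from {F} {X} (suc j) k stop pos =
  next refl (proj₂ (pos k (s≤s (m≤n+m k j))))
    (subst (Eval 7 F (pair (suc k) X)) (+-suc j k)
      (search-from j (suc k)
        (subst (λ y → F ⊢ pair y X ⇓ 0) (sym (+-suc j k)) stop)
        (λ i i< → pos i (subst (i <_) (+-suc j k) i<))))

mutual
  index-⇓ : {f : Recursive n} {xs : Vec ℕ n} {y : ℕ} →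
            f [ xs ]↦ y → index f ⊢ tuple xs ⇓ y
  index-⇓ zero-↦ = _ , _ , refl , zero
  index-⇓ suc-↦ = _ , _ , refl , succ refl
  index-⇓ (proj-↦ {i = i} {xs}) = projIndex-⇓ i xs
  index-⇓ (comp-↦ ps q) = _ , _ , refl , comp refl (index*-⇓ ps) (index-⇓ q)
  index-⇓ (prec-zero-↦ p) = _ , _ , refl , prec-zero refl refl (index-⇓ p)
  -- The induction hypothesis hides its tag and parameter in an existential; injectivity of `pair`
  -- recovers tag 6, which `prec-suc` demands.
  index-⇓ (prec-suc-↦ p q) with _ , _ , e , p′ ← index-⇓ p
    with refl , refl ← pair-injective e =
    _ , _ , refl , prec-suc refl refl p′ (index-⇓ q)
  index-⇓ {f = μ f} {xs} {y} (μ-↦ p pos) = _ , _ , refl , search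
    (subst (Eval 7 (index f) (pair 0 (tuple xs))) (+-identityʳ y)
      (search-from y 0
        (subst (λ y → index f ⊢ pair y (tuple xs) ⇓ 0) (sym (+-identityʳ y)) (index-⇓ p))
        (λ i i< → proj₁ (pos i (subst (i <_) (+-identityʳ y) i<)) ,
                   index-⇓ (proj₂ (pos i (subst (i <_) (+-identityʳ y) i<))))))

  index*-⇓ : {gs : Vec (Recursive n) m} {xs : Vec ℕ n} {ys : Vec ℕ m} →
             gs [ xs ]↦* ys → index* gs ⊢ tuple xs ⇓ tuple ys
  index*-⇓ []       = _ , _ , refl , zero
  index*-⇓ (p ∷ ps) = _ , _ , refl , cons refl (index-⇓ p) (index*-⇓ ps)

-- Natural numbers among the reals

∣p-q∣-comm : ∀ p q → ∣ p ℚ.- q ∣ ≡ ∣ q ℚ.- p ∣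
∣p-q∣-comm p q = trans (sym (ℚₚ.∣-p∣≡∣p∣ (p ℚ.- q))) (cong ∣_∣ (⁻¹-anti-homo-// p q))

split-ε : ∀ ε → 0ℚ ℚ.< ε → ∃ λ δ → ∃ λ η → 0ℚ ℚ.< δ × 0ℚ ℚ.< η × δ ℚ.+ η ≡ ε
split-ε ε 0<ε with δ , 0<δ , δ<ε ← ℚₚ.<-dense 0<ε =
  δ , ε ℚ.- δ , 0<δ ,
  subst (ℚ._< ε ℚ.- δ) (ℚₚ.+-inverseʳ δ) (ℚₚ.+-monoˡ-< (ℚ.- δ) δ<ε) ,
  trans (sym (ℚₚ.+-assoc δ ε (ℚ.- δ))) (xyx⁻¹≈y δ ε)

-- The argument that splits ε in two, made once for both transitivity and congruence of addition.
≃-from-sum : ∀ {a b c d} (x y : ℝ) → a ≃ℝ b → c ≃ℝ d →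
  (∀ n → seq x n ℚ.- seq y n ≡ (seq a n ℚ.- seq b n) ℚ.+ (seq c n ℚ.- seq d n)) → x ≃ℝ y
≃-from-sum {a} {b} {c} {d} x y a≃b c≃d x-y ε 0<ε
  with δ , η , 0<δ , 0<η , δ+η≡ε ← split-ε ε 0<ε
  with M , a-close ← a≃b δ 0<δ
  with N , c-close ← c≃d η 0<η =
  M ⊔ N , λ n M⊔N≤n → begin-strict
    ∣ seq x n ℚ.- seq y n ∣
      ≡⟨ cong ∣_∣ (x-y n) ⟩
    ∣ (seq a n ℚ.- seq b n) ℚ.+ (seq c n ℚ.- seq d n) ∣
      ≤⟨ ℚₚ.∣p+q∣≤∣p∣+∣q∣ (seq a n ℚ.- seq b n) (seq c n ℚ.- seq d n) ⟩
    ∣ seq a n ℚ.- seq b n ∣ ℚ.+ ∣ seq c n ℚ.- seq d n ∣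
      <⟨ ℚₚ.+-mono-< (a-close n (m⊔n≤o⇒m≤o M N M⊔N≤n))
                     (c-close n (m⊔n≤o⇒n≤o M N M⊔N≤n)) ⟩
    δ ℚ.+ η
      ≡⟨ δ+η≡ε ⟩
    ε ∎
  where open ℚₚ.≤-Reasoning

≃-refl : ∀ x → x ≃ℝ x
≃-refl x ε 0<ε = 0 , λ n _ → subst (λ q → ∣ q ∣ ℚ.< ε) (sym (ℚₚ.+-inverseʳ (seq x n))) 0<ε

≃-sym : ∀ {x y} → x ≃ℝ y → y ≃ℝ x
≃-sym {x} {y} x≃y ε 0<ε with N , close ← x≃y ε 0<ε =
  N , λ n N≤n → subst (ℚ._< ε) (∣p-q∣-comm (seq x n) (seq y n)) (close n N≤n)

≃-trans : ∀ {x y z} → x ≃ℝ y → y ≃ℝ z → x ≃ℝ z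
≃-trans {x} {y} {z} x≃y y≃z = ≃-from-sum {x} {y} {y} {z} x z x≃y y≃z λ n →
  sym (telescope (seq x n) (seq y n) (seq z n))
  where
  telescope : ∀ p q r → (p ℚ.- q) ℚ.+ (q ℚ.- r) ≡ p ℚ.- r
  telescope p q r = begin
    (p ℚ.- q) ℚ.+ (q ℚ.- r)       ≡⟨ ℚₚ.+-assoc p (ℚ.- q) (q ℚ.- r) ⟩
    p ℚ.+ (ℚ.- q ℚ.+ (q ℚ.- r))   ≡⟨ cong (p ℚ.+_) (ℚₚ.+-assoc (ℚ.- q) q (ℚ.- r)) ⟨
    p ℚ.+ (ℚ.- q ℚ.+ q ℚ.- r)     ≡⟨ cong (λ s → p ℚ.+ (s ℚ.- r)) (ℚₚ.+-inverseˡ q) ⟩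
    p ℚ.+ (0ℚ ℚ.- r)              ≡⟨ cong (p ℚ.+_) (ℚₚ.+-identityˡ (ℚ.- r)) ⟩
    p ℚ.- r                       ∎
    where open ≡-Reasoning

+ℝ-cong : ∀ {x x′ y y′} → x ≃ℝ x′ → y ≃ℝ y′ → x +ℝ y ≃ℝ x′ +ℝ y′
+ℝ-cong {x} {x′} {y} {y′} x≃x′ y≃y′ =
  ≃-from-sum {x} {x′} {y} {y′} (x +ℝ y) (x′ +ℝ y′) x≃x′ y≃y′ λ n →
  sym (rearrange (seq x n) (seq x′ n) (seq y n) (seq y′ n))
  where
  rearrange : ∀ a b c d → (a ℚ.- b) ℚ.+ (c ℚ.- d) ≡ (a ℚ.+ c) ℚ.- (b ℚ.+ d)
  rearrange a b c d = trans (interchange a (ℚ.- b) c (ℚ.- d))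
    (cong ((a ℚ.+ c) ℚ.+_) (sym (ℚₚ.neg-distrib-+ b d)))

-- If `p` and `q` differed, closeness at ε equal to their distance would make that distance smaller
-- than itself.
fromℚ-injective : ∀ {p q} → fromℚ p ≃ℝ fromℚ q → p ≡ q
fromℚ-injective {p} {q} p≃q with p ℚₚ.≟ q
... | yes p≡q = p≡q
... | no  p≢q
  with N , close ← p≃q ∣ p ℚ.- q ∣ (ℚₚ.≰⇒> λ ∣p-q∣≤0 →
         p≢q (x∙y⁻¹≈ε⇒x≈y p q (ℚₚ.∣p∣≡0⇒p≡0 (p ℚ.- q)
           (ℚₚ.≤-antisym ∣p-q∣≤0 (ℚₚ.0≤∣p∣ (p ℚ.- q)))))) =
  ⊥-elim (ℚₚ.<-irrefl refl (close N ≤-refl))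

ℕ⇒ℚ : ℕ → ℚ
ℕ⇒ℚ zero    = 0ℚ
ℕ⇒ℚ (suc n) = 1ℚ ℚ.+ ℕ⇒ℚ n

ℕ⇒ℚ-+ : ∀ m n → ℕ⇒ℚ (m + n) ≡ ℕ⇒ℚ m ℚ.+ ℕ⇒ℚ n
ℕ⇒ℚ-+ zero    n = sym (ℚₚ.+-identityˡ (ℕ⇒ℚ n))
ℕ⇒ℚ-+ (suc m) n =
  trans (cong (1ℚ ℚ.+_) (ℕ⇒ℚ-+ m n)) (sym (ℚₚ.+-assoc 1ℚ (ℕ⇒ℚ m) (ℕ⇒ℚ n)))

0≤ℕ⇒ℚ : ∀ n → 0ℚ ℚ.≤ ℕ⇒ℚ n
0≤ℕ⇒ℚ zero    = ℚₚ.≤-refl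
0≤ℕ⇒ℚ (suc n) = ℚₚ.+-mono-≤ (ℚₚ.nonNegative⁻¹ 1ℚ) (0≤ℕ⇒ℚ n)

0<ℕ⇒ℚ-suc : ∀ n → 0ℚ ℚ.< ℕ⇒ℚ (suc n)
0<ℕ⇒ℚ-suc n = ℚₚ.+-mono-<-≤ (ℚₚ.positive⁻¹ 1ℚ) (0≤ℕ⇒ℚ n)

ℕ⇒ℚ-injective : ∀ m n → ℕ⇒ℚ m ≡ ℕ⇒ℚ n → m ≡ n
ℕ⇒ℚ-injective zero    zero    eq = refl
ℕ⇒ℚ-injective zero    (suc n) eq = ⊥-elim (ℚₚ.<⇒≢ (0<ℕ⇒ℚ-suc n) eq)
ℕ⇒ℚ-injective (suc m) zero    eq = ⊥-elim (ℚₚ.<⇒≢ (0<ℕ⇒ℚ-suc m) (sym eq))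
ℕ⇒ℚ-injective (suc m) (suc n) eq =
  cong suc (ℕ⇒ℚ-injective m n (∙-cancelˡ 1ℚ _ _ eq))

fromℕ : ℕ → ℝ
fromℕ n = fromℚ (ℕ⇒ℚ n)

fromℕ-injective : ∀ {m n} → fromℕ m ≃ℝ fromℕ n → m ≡ n
fromℕ-injective {m} {n} eq = ℕ⇒ℚ-injective m n (fromℚ-injective eq)

fromℕ-cong : ∀ {m n} → m ≡ n → fromℕ m ≃ℝ fromℕ n
fromℕ-cong {m} refl = ≃-refl (fromℕ m)

-- The two sides have equal sequences, but the ℝ on the right carries another Cauchy modulus.
fromℕ-+ : ∀ m n → fromℕ (m + n) ≃ℝ fromℕ m +ℝ fromℕ n
fromℕ-+ m n ε 0<ε = 0 , λ _ _ → subst (λ q → ∣ q ∣ ℚ.< ε)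
  (sym (trans (cong (ℚ._- (ℕ⇒ℚ m ℚ.+ ℕ⇒ℚ n)) (ℕ⇒ℚ-+ m n)) (ℚₚ.+-inverseʳ (ℕ⇒ℚ m ℚ.+ ℕ⇒ℚ n)))) 0<ε

fromℕ-1 : 1ℝ ≃ℝ fromℕ 1
fromℕ-1 = subst (λ q → 1ℝ ≃ℝ fromℚ q) (sym (ℚₚ.+-identityʳ 1ℚ)) (≃-refl 1ℝ)

-- A fragment of the quantifier-free formulas, interpreted over ℕ

⟦_⟧ℕ : Term n → (Fin n → ℕ) → ℕ
⟦ var i ⟧ℕ α = α i
⟦ 𝟎 ⟧ℕ     α = 0
⟦ 𝟏 ⟧ℕ     α = 1
⟦ s ⊕ t ⟧ℕ α = ⟦ s ⟧ℕ α + ⟦ t ⟧ℕ α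

infix  4 _≐′_
infixr 2 _∧′_
infixr 0 _⇒′_

data Fragment (n : ℕ) : Set where
  P′        : Term n → Fragment n
  _≐′_      : Term n → Term n → Fragment n
  _∧′_ _⇒′_ : Fragment n → Fragment n → Fragment n

⌊_⌋ : Fragment n → QuantifierFree n
⌊ P′ t ⌋   = P[ t ]
⌊ s ≐′ t ⌋ = s ≐ t
⌊ φ ∧′ ψ ⌋ = ⌊ φ ⌋ ∧ ⌊ ψ ⌋
⌊ φ ⇒′ ψ ⌋ = ⌊ φ ⌋ ⇒ ⌊ ψ ⌋

Holdsℕ : (ℕ → Set) → Fragment n → (Fin n → ℕ) → Set
Holdsℕ S (P′ t)   α = S (⟦ t ⟧ℕ α)
Holdsℕ S (s ≐′ t) α = ⟦ s ⟧ℕ α ≡ ⟦ t ⟧ℕ α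
Holdsℕ S (φ ∧′ ψ) α = Holdsℕ S φ α × Holdsℕ S ψ α
Holdsℕ S (φ ⇒′ ψ) α = Holdsℕ S φ α → Holdsℕ S ψ α

⟦⟧-fromℕ : ∀ (t : Term n) {ρ α} → (∀ i → lookup ρ i ≃ℝ fromℕ (α i)) →
           ⟦ t ⟧ ρ ≃ℝ fromℕ (⟦ t ⟧ℕ α)
⟦⟧-fromℕ (var i) ρ≃α = ρ≃α i
⟦⟧-fromℕ 𝟎       ρ≃α = ≃-refl 0ℝ
⟦⟧-fromℕ 𝟏       ρ≃α = fromℕ-1
⟦⟧-fromℕ (s ⊕ t) {ρ} {α} ρ≃α =
  ≃-trans {⟦ s ⟧ ρ +ℝ ⟦ t ⟧ ρ} {fromℕ (⟦ s ⟧ℕ α) +ℝ fromℕ (⟦ t ⟧ℕ α)} {fromℕ (⟦ s ⊕ t ⟧ℕ α)}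
    (+ℝ-cong {⟦ s ⟧ ρ} {fromℕ (⟦ s ⟧ℕ α)} {⟦ t ⟧ ρ} {fromℕ (⟦ t ⟧ℕ α)}
      (⟦⟧-fromℕ s ρ≃α) (⟦⟧-fromℕ t ρ≃α))
    (≃-sym {fromℕ (⟦ s ⊕ t ⟧ℕ α)} {fromℕ (⟦ s ⟧ℕ α) +ℝ fromℕ (⟦ t ⟧ℕ α)}
      (fromℕ-+ (⟦ s ⟧ℕ α) (⟦ t ⟧ℕ α)))

module _ (I : Interpretation) {S : ℕ → Set}
         (P⇔S : ∀ m → Interpretation.P I (fromℕ m) ⇔ S m) where
  open Interpretation I

  -- Implication is contravariant, so both directions go through one induction. Atoms transfer
  -- because `P` respects `_≃ℝ_` and `fromℕ` is injective. It serves arbitrary models as well as the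
  -- constructed one.
  Holds⇔Holdsℕ : ∀ (φ : Fragment n) {ρ α} → (∀ i → lookup ρ i ≃ℝ fromℕ (α i)) →
                 HoldsQF I ⌊ φ ⌋ ρ ⇔ Holdsℕ S φ α
  Holds⇔Holdsℕ (P′ t) {ρ} {α} ρ≃α = mk⇔
    (λ p → to (P⇔S _) (P-respects t≃ p))
    (λ s → P-respects (≃-sym {⟦ t ⟧ ρ} {fromℕ (⟦ t ⟧ℕ α)} t≃) (from (P⇔S _) s))
    where
    t≃ : ⟦ t ⟧ ρ ≃ℝ fromℕ (⟦ t ⟧ℕ α)
    t≃ = ⟦⟧-fromℕ t ρ≃α
  Holds⇔Holdsℕ (s ≐′ t) {ρ} {α} ρ≃α = mk⇔
    (λ s≃t → fromℕ-injective
      (≃-trans {fromℕ (⟦ s ⟧ℕ α)} {⟦ s ⟧ ρ} {fromℕ (⟦ t ⟧ℕ α)}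
        (≃-sym {⟦ s ⟧ ρ} {fromℕ (⟦ s ⟧ℕ α)} s≃)
        (≃-trans {⟦ s ⟧ ρ} {⟦ t ⟧ ρ} {fromℕ (⟦ t ⟧ℕ α)} s≃t t≃)))
    (λ s≡t → ≃-trans {⟦ s ⟧ ρ} {fromℕ (⟦ s ⟧ℕ α)} {⟦ t ⟧ ρ} s≃
      (≃-trans {fromℕ (⟦ s ⟧ℕ α)} {fromℕ (⟦ t ⟧ℕ α)} {⟦ t ⟧ ρ} (fromℕ-cong s≡t)
        (≃-sym {⟦ t ⟧ ρ} {fromℕ (⟦ t ⟧ℕ α)} t≃)))
    where
    s≃ : ⟦ s ⟧ ρ ≃ℝ fromℕ (⟦ s ⟧ℕ α)
    s≃ = ⟦⟧-fromℕ s ρ≃α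
    t≃ : ⟦ t ⟧ ρ ≃ℝ fromℕ (⟦ t ⟧ℕ α)
    t≃ = ⟦⟧-fromℕ t ρ≃α
  Holds⇔Holdsℕ (φ ∧′ ψ) ρ≃α = mk⇔
    (λ (p , q) → to (Holds⇔Holdsℕ φ ρ≃α) p , to (Holds⇔Holdsℕ ψ ρ≃α) q)
    (λ (p , q) → from (Holds⇔Holdsℕ φ ρ≃α) p , from (Holds⇔Holdsℕ ψ ρ≃α) q)
  Holds⇔Holdsℕ (φ ⇒′ ψ) ρ≃α = mk⇔
    (λ f p → to (Holds⇔Holdsℕ ψ ρ≃α) (f (from (Holds⇔Holdsℕ φ ρ≃α) p)))
    (λ f p → from (Holds⇔Holdsℕ ψ ρ≃α) (f (to (Holds⇔Holdsℕ φ ρ≃α) p)))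

-- Horn clauses about numbers built with pair

infixr 5 _⸴_
infixr 4 _⟶_

data Pattern (k : ℕ) : Set where
  v   : Fin k → Pattern k
  lit : ℕ → Pattern k
  S   : Pattern k → Pattern k
  _⸴_ : Pattern k → Pattern k → Pattern k

data Clause (k : ℕ) : Set where
  absurd : Clause k
  fact   : Pattern k → Clause k
  _⟶_    : Pattern k → Clause k → Clause k

value : Pattern k → (Fin k → ℕ) → ℕ
value (v i)   ν = ν i
value (lit c) ν = c
value (S p)   ν = suc (value p ν)
value (p ⸴ q) ν = pair (value p ν) (value q ν)

HoldsClause : (ℕ → Set) → Clause k → (Fin k → ℕ) → Set
HoldsClause Q absurd   ν = ⊥
HoldsClause Q (fact p) ν = Q (value p ν)
HoldsClause Q (p ⟶ c)  ν = Q (value p ν) → HoldsClause Q c ν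

-- The term for pair a b is d + (a + b) + b, where d is a variable of its own, a slot, which
-- the atoms of pairings force to be slack a b.
slots : Pattern k → ℕ
slots (v i)   = 0
slots (lit c) = 0
slots (S p)   = slots p
slots (p ⸴ q) = suc (slots p + slots q)

slotsC : Clause k → ℕ
slotsC absurd   = 0
slotsC (fact p) = slots p
slotsC (p ⟶ c)  = slots p + slotsC c

fill : (p : Pattern k) → (Fin k → ℕ) → Fin (slots p) → ℕ
fill (S p)   ν j       = fill p ν j
fill (p ⸴ q) ν zero    = slack (value p ν) (value q ν)
fill (p ⸴ q) ν (suc j) = [ fill p ν , fill q ν ]′ (splitAt (slots p) j)

fillC : (c : Clause k) → (Fin k → ℕ) → Fin (slotsC c) → ℕ
fillC (fact p) ν j = fill p ν j
fillC (p ⟶ c)  ν j = [ fill p ν , fillC c ν ]′ (splitAt (slots p) j)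

-- P is a set of natural numbers, sorted by residues modulo 9:
--   9n, 9n + 1 : all n;   9n + 3 : n = 2 ^ e;   9n + 5 : n = 2 ^ e + e;
--   9n + 7 : n codes a derivable judgement.
-- Only the first two are adjacent, so P(y) and P(y + 1) single out the reals y = 9n; the
-- number n is represented by such a y throughout.
numeral : ℕ → Term n
numeral zero    = 𝟎
numeral (suc r) = 𝟏 ⊕ numeral r

multiple : ℕ → Term n
multiple zero    = 𝟎
multiple (suc e) = multiple e ⊕ numeral 9

⟦multiple⟧ : ∀ e {α : Fin n → ℕ} → ⟦ multiple e ⟧ℕ α ≡ e * 9
⟦multiple⟧ zero    = refl
⟦multiple⟧ (suc e) = trans (cong (_+ 9) (⟦multiple⟧ e)) (+-comm (e * 9) 9)

private
  ·9-sum : ∀ d a → d * 9 + a * 9 ≡ (d + a) * 9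
  ·9-sum = solve-∀

  ·9-sum₂ : ∀ d a → d * 9 + a * 9 + a * 9 ≡ (d + a + a) * 9
  ·9-sum₂ = solve-∀

  ·9-double : ∀ d a → d * 9 + a * 9 + (d * 9 + a * 9) ≡ 2 * (d + a) * 9
  ·9-double = solve-∀

  ·9-double-suc : ∀ d a → d * 9 + a * 9 + (d * 9 + a * 9) + a * 9 + 9 ≡
                          (2 * (d + a) + suc a) * 9
  ·9-double-suc = solve-∀

  ·9-pair : ∀ d a b → d * 9 + (a * 9 + b * 9) ≡ (d + (a + b)) * 9
  ·9-pair = solve-∀

  ·9-pair₂ : ∀ d a b → d * 9 + (a * 9 + b * 9) + (a * 9 + b * 9) ≡ (d + (a + b) + (a + b)) * 9
  ·9-pair₂ = solve-∀

  ·9-pair-value : ∀ d a b → d * 9 + (a * 9 + b * 9) + b * 9 ≡ (d + (a + b) + b) * 9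
  ·9-pair-value = solve-∀

-- Translation of clauses into linear formulas.

module _ (x : Fin k → Fin n) where

  term : (p : Pattern k) → (Fin (slots p) → Fin n) → Term n
  term (v i)   s = var (x i)
  term (lit c) s = multiple c
  term (S p)   s = term p s ⊕ numeral 9
  term (p ⸴ q) s = (var (s zero) ⊕ (a ⊕ b)) ⊕ b
    where
    a b : Term n
    a = term p (s ∘ suc ∘ (_↑ˡ slots q))
    b = term q (s ∘ suc ∘ (slots p ↑ʳ_))

  -- The two atoms for `p ⸴ q` are the hypotheses of `slack-unique`, read in the residue classes 3
  -- and 5. Variables and literals impose nothing, hence the trivial equation.
  pairings : (p : Pattern k) → (Fin (slots p) → Fin n) → Fragment n
  pairings (v i)   s = 𝟎 ≐′ 𝟎
  pairings (lit c) s = 𝟎 ≐′ 𝟎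
  pairings (S p)   s = pairings p s
  pairings (p ⸴ q) s =
    pairings p sp ∧′ pairings q sq ∧′
    P′ ((var (s zero) ⊕ (a ⊕ b)) ⊕ numeral 3) ∧′
    P′ (((var (s zero) ⊕ (a ⊕ b)) ⊕ (a ⊕ b)) ⊕ numeral 5)
    where
    sp : Fin (slots p) → Fin n
    sp = s ∘ suc ∘ (_↑ˡ slots q)
    sq : Fin (slots q) → Fin n
    sq = s ∘ suc ∘ (slots p ↑ʳ_)
    a b : Term n
    a = term p sp
    b = term q sq

  -- Even the pairings of a head are premises: wrong slot values make the formula vacuous, so
  -- universally quantified slots do no harm. Falsity is expressed by `𝟏 ≐′ 𝟎`.
  clause : (c : Clause k) → (Fin (slotsC c) → Fin n) → Fragment n
  clause absurd   s = 𝟏 ≐′ 𝟎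
  clause (fact p) s = pairings p s ⇒′ P′ (term p s ⊕ numeral 7)
  clause (p ⟶ c)  s =
    pairings p (s ∘ (_↑ˡ slotsC c)) ∧′ P′ (term p (s ∘ (_↑ˡ slotsC c)) ⊕ numeral 7) ⇒′
    clause c (s ∘ (slots p ↑ʳ_))

-- Truth of translated clauses over the natural numbers.

module _ {x : Fin k → Fin n} {ν : Fin k → ℕ} {α : Fin n → ℕ} (αx≡ν : ∀ i → α (x i) ≡ ν i) where

  α·9 : Fin n → ℕ
  α·9 i = α i * 9

  Filled : (p : Pattern k) → (Fin (slots p) → Fin n) → Set
  Filled (v i)   s = ⊤
  Filled (lit c) s = ⊤
  Filled (S p)   s = Filled p s
  Filled (p ⸴ q) s =
    α (s zero) ≡ slack (value p ν) (value q ν) ×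
    Filled p (s ∘ suc ∘ (_↑ˡ slots q)) × Filled q (s ∘ suc ∘ (slots p ↑ʳ_))

  fill-Filled : ∀ p s → (∀ j → α (s j) ≡ fill p ν j) → Filled p s
  fill-Filled (v i)   s αs≡ = tt
  fill-Filled (lit c) s αs≡ = tt
  fill-Filled (S p)   s αs≡ = fill-Filled p s αs≡
  fill-Filled (p ⸴ q) s αs≡ = αs≡ zero ,
    fill-Filled p _ (λ j → trans (αs≡ (suc (j ↑ˡ slots q)))
      (cong [ fill p ν , fill q ν ]′ (splitAt-↑ˡ (slots p) j (slots q)))) ,
    fill-Filled q _ (λ j → trans (αs≡ (suc (slots p ↑ʳ j)))
      (cong [ fill p ν , fill q ν ]′ (splitAt-↑ʳ (slots p) (slots q) j)))

  ⟦term⟧ : ∀ p s → Filled p s → ⟦ term x p s ⟧ℕ α·9 ≡ value p ν * 9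
  ⟦term⟧ (v i)   s good = cong (_* 9) (αx≡ν i)
  ⟦term⟧ (lit c) s good = ⟦multiple⟧ c
  ⟦term⟧ (S p)   s good = trans (cong (_+ 9) (⟦term⟧ p s good)) (+-comm (value p ν * 9) 9)
  ⟦term⟧ (p ⸴ q) s (d≡ , good-p , good-q)
    rewrite ⟦term⟧ p _ good-p | ⟦term⟧ q _ good-q | d≡ =
    trans (·9-pair-value (slack (value p ν) (value q ν)) (value p ν) (value q ν))
      (cong (_* 9) (slack-pair (value p ν) (value q ν)))

  module _ {T : ℕ → Set} where

    pairings-hold : (∀ e → T (2 ^ e * 9 + 3) × T ((2 ^ e + e) * 9 + 5)) →
                    ∀ p s → Filled p s → Holdsℕ T (pairings x p s) α·9
    pairings-hold exp (v i)   s good = refl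
    pairings-hold exp (lit c) s good = refl
    pairings-hold exp (S p)   s good = pairings-hold exp p s good
    pairings-hold exp (p ⸴ q) s (d≡ , good-p , good-q)
      rewrite ⟦term⟧ p _ good-p | ⟦term⟧ q _ good-q | d≡ =
      pairings-hold exp p _ good-p , pairings-hold exp q _ good-q ,
      subst (λ u → T (u + 3)) (sym (trans (·9-pair d a b) (cong (_* 9) (slack-2^ a b))))
        (proj₁ (exp (a + b))) ,
      subst (λ u → T (u + 5))
        (sym (trans (·9-pair₂ d a b) (cong (λ u → (u + (a + b)) * 9) (slack-2^ a b))))
        (proj₂ (exp (a + b)))
      where
      a b d : ℕ
      a = value p ν
      b = value q ν
      d = slack a b

    -- Subpatterns come first: their slots must be right before their terms denote the values to
    -- which `slack-unique` is applied.
    pairings-filled : (∀ {n} → T (n * 9 + 3) → ∃ λ e → n ≡ 2 ^ e) →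
                      (∀ {n} → T (n * 9 + 5) → ∃ λ e → n ≡ 2 ^ e + e) →
                      ∀ p s → Holdsℕ T (pairings x p s) α·9 → Filled p s
    pairings-filled E₀ E₁ (v i)   s h = tt
    pairings-filled E₀ E₁ (lit c) s h = tt
    pairings-filled E₀ E₁ (S p)   s h = pairings-filled E₀ E₁ p s h
    pairings-filled E₀ E₁ (p ⸴ q) s (h-p , h-q , h₀ , h₁)
      with good-p ← pairings-filled E₀ E₁ p _ h-p
      with good-q ← pairings-filled E₀ E₁ q _ h-q
      rewrite ⟦term⟧ p _ good-p | ⟦term⟧ q _ good-q =
      slack-unique a b (E₀ (subst (λ u → T (u + 3)) (·9-pair d a b) h₀))
        (E₁ (subst (λ u → T (u + 5)) (·9-pair₂ d a b) h₁)) , good-p , good-q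
      where
      a b d : ℕ
      a = value p ν
      b = value q ν
      d = α (s zero)

    -- This direction only needs the true powers to belong to `T`, which every model guarantees: the
    -- intended slot values then satisfy all pairings.
    clause-elim : (∀ e → T (2 ^ e * 9 + 3) × T ((2 ^ e + e) * 9 + 5)) →
                  ∀ c s → (∀ j → α (s j) ≡ fillC c ν j) →
                  Holdsℕ T (clause x c s) α·9 → HoldsClause (λ u → T (u * 9 + 7)) c ν
    clause-elim exp absurd   s αs≡ ()
    clause-elim exp (fact p) s αs≡ h =
      subst (λ u → T (u + 7)) (⟦term⟧ p s good) (h (pairings-hold exp p s good))
      where
      good : Filled p s
      good = fill-Filled p s αs≡
    clause-elim exp (p ⟶ c)  s αs≡ h t =
      clause-elim exp c _
        (λ j → trans (αs≡ (slots p ↑ʳ j))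
          (cong [ fill p ν , fillC c ν ]′ (splitAt-↑ʳ (slots p) (slotsC c) j)))
        (h (pairings-hold exp p _ good , subst (λ u → T (u + 7)) (sym (⟦term⟧ p _ good)) t))
      where
      good : Filled p (s ∘ (_↑ˡ slotsC c))
      good = fill-Filled p _ (λ j → trans (αs≡ (j ↑ˡ slotsC c))
        (cong [ fill p ν , fillC c ν ]′ (splitAt-↑ˡ (slots p) j (slotsC c))))

    -- Here `T` must contain nothing but true powers in the residue classes 3 and 5, so that slots
    -- satisfying the pairings have the intended values.
    clause-intro : (∀ {n} → T (n * 9 + 3) → ∃ λ e → n ≡ 2 ^ e) →
                   (∀ {n} → T (n * 9 + 5) → ∃ λ e → n ≡ 2 ^ e + e) →
                   ∀ c s → HoldsClause (λ u → T (u * 9 + 7)) c ν →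
                   Holdsℕ T (clause x c s) α·9
    clause-intro E₀ E₁ absurd   s h = ⊥-elim h
    clause-intro E₀ E₁ (fact p) s h ps =
      subst (λ u → T (u + 7)) (sym (⟦term⟧ p s (pairings-filled E₀ E₁ p s ps))) h
    clause-intro E₀ E₁ (p ⟶ c)  s h (ps , t) =
      clause-intro E₀ E₁ c _
        (h (subst (λ u → T (u + 7)) (⟦term⟧ p _ (pairings-filled E₀ E₁ p _ ps)) t))

-- Rules over a common stock of variables.

extend : m ≤ n → (Fin m → ℕ) → Fin n → ℕ
extend z≤n       f i       = 0
extend (s≤s m≤n) f zero    = f zero
extend (s≤s m≤n) f (suc i) = extend m≤n (f ∘ suc) i

extend-inject≤ : ∀ (m≤n : m ≤ n) f i → extend m≤n f (inject≤ i m≤n) ≡ f i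
extend-inject≤ (s≤s m≤n) f zero    = refl
extend-inject≤ (s≤s m≤n) f (suc i) = extend-inject≤ m≤n (f ∘ suc) i

-- All rules are conjuncts of one matrix under the same quantifiers, so each places its variables,
-- then its slots, among the first of `n` variables. The bound `fits` is settled by evaluation.
record Rule (n : ℕ) : Set where
  constructor rule
  field
    {arity} : ℕ
    body    : Clause arity
    {fits}  : True (arity + slotsC body ≤? n)

  arity+slots≤ : arity + slotsC body ≤ n
  arity+slots≤ = toWitness fits

  variables : Fin arity → Fin n
  variables i = inject≤ (i ↑ˡ slotsC body) arity+slots≤

  slotVariables : Fin (slotsC body) → Fin n
  slotVariables j = inject≤ (arity ↑ʳ j) arity+slots≤

  assignment : (Fin arity → ℕ) → Fin n → ℕ
  assignment ν = extend arity+slots≤ ([ ν , fillC body ν ]′ ∘ splitAt arity)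

  assignment-variables : ∀ ν i → assignment ν (variables i) ≡ ν i
  assignment-variables ν i = trans (extend-inject≤ arity+slots≤ _ (i ↑ˡ slotsC body))
    (cong [ ν , fillC body ν ]′ (splitAt-↑ˡ arity i (slotsC body)))

  assignment-slots : ∀ ν j → assignment ν (slotVariables j) ≡ fillC body ν j
  assignment-slots ν j = trans (extend-inject≤ arity+slots≤ _ (arity ↑ʳ j))
    (cong [ ν , fillC body ν ]′ (splitAt-↑ʳ arity (slotsC body) j))

open Rule

formula : Rule n → Fragment n
formula r = clause (variables r) (body r) (slotVariables r)

formulas : List (Rule n) → Fragment n
formulas []       = 𝟎 ≐′ 𝟎
formulas (r ∷ rs) = formula r ∧′ formulas rs

-- The number of variables and slots of the largest clause, that of prec-suc.
V : ℕ
V = 20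

𝑣 : ∀ i {k} {i<k : True (i <? k)} → Pattern k
𝑣 i {i<k = i<k} = v (#_ i {m<n = i<k})

⟪_,_,_⟫ : Pattern k → Pattern k → Pattern k → Pattern k
⟪ F , X , y ⟫ = (F ⸴ X) ⸴ y

-- One rule per constructor of Eval, in the same order.
evalRules : List (Rule V)
evalRules =
  rule {arity = 2} (fact ⟪ lit 0 ⸴ 𝑣 0 , 𝑣 1 , lit 0 ⟫) ∷
  rule {arity = 2} (fact ⟪ lit 1 ⸴ 𝑣 0 , 𝑣 1 ⸴ lit 0 , S (𝑣 1) ⟫) ∷
  rule {arity = 3} (fact ⟪ lit 2 ⸴ 𝑣 0 , 𝑣 1 ⸴ 𝑣 2 , 𝑣 1 ⟫) ∷
  rule {arity = 4} (⟪ 𝑣 0 , 𝑣 2 , 𝑣 3 ⟫ ⟶ fact ⟪ lit 3 ⸴ 𝑣 0 , 𝑣 1 ⸴ 𝑣 2 , 𝑣 3 ⟫) ∷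
  rule {arity = 5} (⟪ 𝑣 1 , 𝑣 2 , 𝑣 3 ⟫ ⟶ ⟪ 𝑣 0 , 𝑣 3 , 𝑣 4 ⟫ ⟶
                    fact ⟪ lit 4 ⸴ 𝑣 0 ⸴ 𝑣 1 , 𝑣 2 , 𝑣 4 ⟫) ∷
  rule {arity = 5} (⟪ 𝑣 0 , 𝑣 2 , 𝑣 3 ⟫ ⟶ ⟪ 𝑣 1 , 𝑣 2 , 𝑣 4 ⟫ ⟶
                    fact ⟪ lit 5 ⸴ 𝑣 0 ⸴ 𝑣 1 , 𝑣 2 , 𝑣 3 ⸴ 𝑣 4 ⟫) ∷
  rule {arity = 4} (⟪ 𝑣 0 , 𝑣 2 , 𝑣 3 ⟫ ⟶
                    fact ⟪ lit 6 ⸴ 𝑣 0 ⸴ 𝑣 1 , lit 0 ⸴ 𝑣 2 , 𝑣 3 ⟫) ∷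
  rule {arity = 6} (⟪ lit 6 ⸴ 𝑣 0 ⸴ 𝑣 1 , 𝑣 2 ⸴ 𝑣 3 , 𝑣 4 ⟫ ⟶
                    ⟪ 𝑣 1 , 𝑣 2 ⸴ 𝑣 4 ⸴ 𝑣 3 , 𝑣 5 ⟫ ⟶
                    fact ⟪ lit 6 ⸴ 𝑣 0 ⸴ 𝑣 1 , S (𝑣 2) ⸴ 𝑣 3 , 𝑣 5 ⟫) ∷
  rule {arity = 3} (⟪ 𝑣 0 , 𝑣 1 ⸴ 𝑣 2 , lit 0 ⟫ ⟶ fact ⟪ lit 7 ⸴ 𝑣 0 , 𝑣 1 ⸴ 𝑣 2 , 𝑣 1 ⟫) ∷
  rule {arity = 5} (⟪ 𝑣 0 , 𝑣 1 ⸴ 𝑣 2 , S (𝑣 3) ⟫ ⟶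
                    ⟪ lit 7 ⸴ 𝑣 0 , S (𝑣 1) ⸴ 𝑣 2 , 𝑣 4 ⟫ ⟶
                    fact ⟪ lit 7 ⸴ 𝑣 0 , 𝑣 1 ⸴ 𝑣 2 , 𝑣 4 ⟫) ∷
  rule {arity = 3} (⟪ lit 7 ⸴ 𝑣 0 , lit 0 ⸴ 𝑣 1 , 𝑣 2 ⟫ ⟶
                    fact ⟪ lit 8 ⸴ 𝑣 0 , 𝑣 1 , 𝑣 2 ⟫) ∷
  []

-- Derivable judgements as the least set closed under the rules.

judgement : ℕ → ℕ → ℕ → ℕ
judgement F X y = pair (pair F X) y

Closed : (ℕ → Set) → Rule n → Set
Closed Q r = ∀ ν → HoldsClause Q (body r) ν

Derivable : ℕ → Set
Derivable c = ∃ λ F → ∃₂ λ X y → c ≡ judgement F X y × F ⊢ X ⇓ y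

derivable : ∀ {F X y} → F ⊢ X ⇓ y → Derivable (judgement F X y)
derivable p = _ , _ , _ , refl , p

derivation : ∀ {F X y} → Derivable (judgement F X y) → F ⊢ X ⇓ y
derivation (_ , _ , _ , eq , p)
  with eq′ , refl ← pair-injective eq
  with refl , refl ← pair-injective eq′ = p

-- Inversion for premises with a fixed tag, as in `prec-suc`, `next` and `search`.
evaluation : ∀ {t a X y} → Derivable (judgement (pair t a) X y) → Eval t a X y
evaluation d with _ , _ , eq , p ← derivation d
  with refl , refl ← pair-injective eq = p

Derivable-closed : All (Closed Derivable) evalRules
Derivable-closed =
  (λ ν → derivable (_ , _ , refl , zero)) ∷
  (λ ν → derivable (_ , _ , refl , succ refl)) ∷
  (λ ν → derivable (_ , _ , refl , head refl)) ∷
  (λ ν d → derivable (_ , _ , refl , tail refl (derivation d))) ∷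
  (λ ν d e → derivable (_ , _ , refl , comp refl (derivation d) (derivation e))) ∷
  (λ ν d e → derivable (_ , _ , refl , cons refl (derivation d) (derivation e))) ∷
  (λ ν d → derivable (_ , _ , refl , prec-zero refl refl (derivation d))) ∷
  (λ ν d e → derivable (_ , _ , refl , prec-suc refl refl (evaluation d) (derivation e))) ∷
  (λ ν d → derivable (_ , _ , refl , found refl (derivation d))) ∷
  (λ ν d e → derivable (_ , _ , refl , next refl (derivation d) (evaluation e))) ∷
  (λ ν d → derivable (_ , _ , refl , search (evaluation d))) ∷
  []

module _ {Q : ℕ → Set} (closed : All (Closed Q) evalRules) where
  use : ∀ i → Closed Q (List.lookup evalRules i)
  use i = All.lookup closed (∈-lookup i)

  mutual
    -- Induction on the evaluation: each constructor is matched by its rule, whose variables are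
    -- instantiated in the order of their numbering.
    Eval-least : ∀ {t a X y} → Eval t a X y → Q (judgement (pair t a) X y)
    Eval-least {a = a} {X} zero =
      use (# 0) (lookup (a ∷ X ∷ []))
    Eval-least {a = a} (succ {x = x} refl) =
      use (# 1) (lookup (a ∷ x ∷ []))
    Eval-least {a = a} (head {x = x} {X′} refl) =
      use (# 2) (lookup (a ∷ x ∷ X′ ∷ []))
    Eval-least {a = a} {y = y} (tail {x = x} {X′} refl p) =
      use (# 3) (lookup (a ∷ x ∷ X′ ∷ y ∷ [])) (⇓-least p)
    Eval-least {X = X} {z} (comp {F = F} {G} {Y} refl p q) =
      use (# 4) (lookup (F ∷ G ∷ X ∷ Y ∷ z ∷ [])) (⇓-least p) (⇓-least q)
    Eval-least {X = X} (cons {F = F} {G} {y} {Y} refl p q) =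
      use (# 5) (lookup (F ∷ G ∷ X ∷ y ∷ Y ∷ [])) (⇓-least p) (⇓-least q)
    Eval-least {y = z} (prec-zero {F = F} {G} {X′} refl refl p) =
      use (# 6) (lookup (F ∷ G ∷ X′ ∷ z ∷ [])) (⇓-least p)
    Eval-least {y = z} (prec-suc {F = F} {G} {k} {X′} {y} refl refl p q) =
      use (# 7) (lookup (F ∷ G ∷ k ∷ X′ ∷ y ∷ z ∷ [])) (Eval-least p) (⇓-least q)
    Eval-least {a = a} (found {k = k} {X′} refl p) =
      use (# 8) (lookup (a ∷ k ∷ X′ ∷ [])) (⇓-least p)
    Eval-least {a = a} {y = y} (next {k = k} {X′} {w} refl p q) =
      use (# 9) (lookup (a ∷ k ∷ X′ ∷ w ∷ y ∷ [])) (⇓-least p) (Eval-least q)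
    Eval-least {a = a} {X} {y} (search p) =
      use (# 10) (lookup (a ∷ X ∷ y ∷ [])) (Eval-least p)

    ⇓-least : ∀ {F X y} → F ⊢ X ⇓ y → Q (judgement F X y)
    ⇓-least (_ , _ , refl , e) = Eval-least e

-- The sentences

conjunction : (Fin k → Fragment n) → Fragment n
conjunction {zero}  φ = 𝟎 ≐′ 𝟎
conjunction {suc k} φ = φ zero ∧′ conjunction (φ ∘ suc)

conjunction⁻ : ∀ I (φ : Fin k → Fragment n) {ρ} →
               HoldsQF I ⌊ conjunction φ ⌋ ρ → ∀ i → HoldsQF I ⌊ φ i ⌋ ρ
conjunction⁻ I φ (h , hs) zero    = h
conjunction⁻ I φ (h , hs) (suc i) = conjunction⁻ I (φ ∘ suc) hs i

conjunction⁺ : ∀ {T α} (φ : Fin k → Fragment n) →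
               (∀ i → Holdsℕ T (φ i) α) → Holdsℕ T (conjunction φ) α
conjunction⁺ {k = zero}  φ h = refl
conjunction⁺ {k = suc k} φ h = h zero , conjunction⁺ (φ ∘ suc) (h ∘ suc)

formulas⁻ : ∀ {T α} (rs : List (Rule n)) → Holdsℕ T (formulas rs) α →
            All (λ r → Holdsℕ T (formula r) α) rs
formulas⁻ []       h        = []
formulas⁻ (r ∷ rs) (h , hs) = h ∷ formulas⁻ rs hs

formulas⁺ : ∀ {T α} {rs : List (Rule n)} → All (λ r → Holdsℕ T (formula r) α) rs →
            Holdsℕ T (formulas rs) α
formulas⁺ []       = refl
formulas⁺ (h ∷ hs) = h , formulas⁺ hs

x₀ x₁ : Term (2 + n)
x₀ = var zero
x₁ = var (suc zero)

origin : Fragment n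
origin = P′ 𝟎 ∧′ P′ 𝟏

marks : Fin n → Fragment n
marks i = P′ (var i) ∧′ P′ (var i ⊕ 𝟏)

guard : Fragment n
guard = conjunction marks

-- Generates the residue classes 0, 1, 3 and 5: with x₀ an exponent and x₁ + x₀ its power of 2,
-- the last clause passes from (x₀ , t) to (x₀ + 1 , 2t).
arithmetic : Fragment (2 + n)
arithmetic =
  (P′ (x₀ ⊕ numeral 9) ∧′ P′ ((x₀ ⊕ numeral 9) ⊕ 𝟏)) ∧′
  (P′ (numeral 9 ⊕ numeral 3) ∧′ P′ (numeral 9 ⊕ numeral 5)) ∧′
  (P′ ((x₁ ⊕ x₀) ⊕ numeral 3) ∧′ P′ (((x₁ ⊕ x₀) ⊕ x₀) ⊕ numeral 5) ⇒′
   P′ (((x₁ ⊕ x₀) ⊕ (x₁ ⊕ x₀)) ⊕ numeral 3) ∧′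
   P′ (((((x₁ ⊕ x₀) ⊕ (x₁ ⊕ x₀)) ⊕ x₀) ⊕ numeral 9) ⊕ numeral 5))

-- `origin` stands outside the guard to start the induction that marks all multiples of 9. The
-- number `e` enters only through the term `multiple e`, which keeps the code easily computable from
-- `e`.
sentenceMatrix : List (Rule (2 + n)) → Rule (2 + n) → ℕ → QuantifierFree (2 + n)
sentenceMatrix rs goal e = ⌊ origin ⌋ ∧
  (⌊ guard ⌋ ⇒ ⌊ arithmetic ∧′ formulas rs ⌋ ∧ (x₀ ≐ multiple e ⇒ ⌊ formula goal ⌋))

close : Universal n → UniversalSentence
close {zero}  φ = φ
close {suc n} φ = close (forall′ φ)

close⁺ : ∀ I (φ : Universal n) → (∀ ρ → Holds I φ ρ) → Holds I (close φ) []
close⁺ {zero}  I φ h = h []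
close⁺ {suc n} I φ h = close⁺ I (forall′ φ) λ ρ x → h (x ∷ ρ)

close⁻ : ∀ I (φ : Universal n) → Holds I (close φ) [] → ∀ ρ → Holds I φ ρ
close⁻ {zero}  I φ h []      = h
close⁻ {suc n} I φ h (x ∷ ρ) = close⁻ I (forall′ φ) h ρ x

sentence : List (Rule (2 + n)) → Rule (2 + n) → ℕ → UniversalSentence
sentence rs goal e = close (matrix (sentenceMatrix rs goal e))

-- Every model satisfies the rules

module Refutation (I : Interpretation) (rs : List (Rule (2 + n))) (goal : Rule (2 + n)) (e : ℕ)
                  (model : Holds I (sentence rs goal e) []) where
  open Interpretation I

  axioms : Fragment (2 + n)
  axioms = arithmetic ∧′ formulas rs

  T : ℕ → Set
  T m = P (fromℕ m)

  scaled : (Fin (2 + n) → ℕ) → Vec ℝ (2 + n)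
  scaled α = tabulate λ i → fromℕ (α i * 9)

  transfer : ∀ (φ : Fragment (2 + n)) α → HoldsQF I ⌊ φ ⌋ (scaled α) ⇔ Holdsℕ T φ (λ i → α i * 9)
  transfer φ α = Holds⇔Holdsℕ I (λ m → mk⇔ (λ p → p) (λ p → p)) φ λ i →
    subst (_≃ℝ fromℕ (α i * 9)) (sym (lookup∘tabulate (λ i → fromℕ (α i * 9)) i))
      (≃-refl (fromℕ (α i * 9)))

  matrix-holds : ∀ α → HoldsQF I (sentenceMatrix rs goal e) (scaled α)
  matrix-holds α = close⁻ I (matrix (sentenceMatrix rs goal e)) model (scaled α)

  T-0-1 : T 0 × T 1
  T-0-1 = to (transfer origin λ _ → 0) (proj₁ (matrix-holds λ _ → 0))

  Marked : ℕ → Set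
  Marked n = T (n * 9) × T (n * 9 + 1)

  instantiate : ∀ α → (∀ i → Marked (α i)) →
    HoldsQF I (⌊ axioms ⌋ ∧ (x₀ ≐ multiple e ⇒ ⌊ formula goal ⌋)) (scaled α)
  instantiate α marked =
    proj₂ (matrix-holds α) (from (transfer guard α) (conjunction⁺ marks marked))

  -- All variables receive the same value, so the induction hypothesis alone discharges the guard,
  -- and `arithmetic` yields the next multiple of 9.
  marked : ∀ n → Marked n
  marked zero    = T-0-1
  marked (suc n) = subst T (+-comm (n * 9) 9) t , subst T (cong (_+ 1) (+-comm (n * 9) 9)) t′
    where
    successor : T (n * 9 + 9) × T (n * 9 + 9 + 1)
    successor = proj₁ (to (transfer arithmetic λ _ → n)
      (proj₁ (proj₁ (instantiate (λ _ → n) λ _ → marked n))))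
    t  = proj₁ successor
    t′ = proj₂ successor

  axioms-hold : ∀ α → Holdsℕ T axioms (λ i → α i * 9)
  axioms-hold α = to (transfer axioms α) (proj₁ (instantiate α (marked ∘ α)))

  exponentials : ∀ e → T (2 ^ e * 9 + 3) × T ((2 ^ e + e) * 9 + 5)
  exponentials zero = proj₁ (proj₂ (proj₁ (axioms-hold λ _ → 0)))
  exponentials (suc e) =
    subst (λ u → T (u + 3)) (trans (·9-double d e) (cong (λ u → 2 * u * 9) d+e)) (proj₁ step) ,
    subst (λ u → T (u + 5))
      (trans (·9-double-suc d e) (cong (λ u → (2 * u + suc e) * 9) d+e)) (proj₂ step)
    where
    d : ℕ
    -- This value of `x₁` makes `x₁ ⊕ x₀` denote the power of 2 with exponent `x₀`; the variables
    -- beyond these two may be any marked number, here 0.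
    d = 2 ^ e ∸ e
    d+e : d + e ≡ 2 ^ e
    d+e = m∸n+n≡m (<⇒≤ (n<2^n e))
    α : Fin (2 + n) → ℕ
    α zero       = e
    α (suc zero) = d
    α _          = 0
    step : T (d * 9 + e * 9 + (d * 9 + e * 9) + 3) ×
           T (d * 9 + e * 9 + (d * 9 + e * 9) + e * 9 + 9 + 5)
    step = proj₂ (proj₂ (proj₁ (axioms-hold α)))
      ( subst (λ u → T (u + 3)) (sym (trans (·9-sum d e) (cong (_* 9) d+e)))
          (proj₁ (exponentials e))
      , subst (λ u → T (u + 5)) (sym (trans (·9-sum₂ d e) (cong (λ u → (u + e) * 9) d+e)))
          (proj₂ (exponentials e)) )

  R : ℕ → Set
  R c = T (c * 9 + 7)

  rule-elim : ∀ (r : Rule (2 + n)) ν → Holdsℕ T (formula r) (λ i → assignment r ν i * 9) →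
               HoldsClause R (body r) ν
  rule-elim r ν = clause-elim {α = assignment r ν} (assignment-variables r ν)
    exponentials (body r) (slotVariables r) (assignment-slots r ν)

  closed : All (Closed R) rs
  closed = All.tabulate λ {r} r∈ ν →
    rule-elim r ν (All.lookup (formulas⁻ rs (proj₂ (axioms-hold (assignment r ν)))) r∈)

  goal-holds : ∀ ν → assignment goal ν zero ≡ e → HoldsClause R (body goal) ν
  goal-holds ν α₀≡e =
    rule-elim goal ν (to (transfer (formula goal) α) (proj₂ (instantiate α (marked ∘ α))
        (from (transfer (x₀ ≐′ multiple e) α) (trans (cong (_* 9) α₀≡e) (sym (⟦multiple⟧ e))))))
    where
    α : Fin (2 + n) → ℕ
    α = assignment goal ν

-- A model

-- Layer q m: the number 9q + m belongs to P.
Layer : ℕ → ℕ → Set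
Layer q 0 = ⊤
Layer q 1 = ⊤
Layer q 3 = ∃ λ e → q ≡ 2 ^ e
Layer q 5 = ∃ λ e → q ≡ 2 ^ e + e
Layer q 7 = Derivable q
Layer q (suc (suc (suc (suc (suc (suc (suc (suc (suc m))))))))) = Layer (suc q) m
Layer q _ = ⊥

Layer-+ : ∀ n {q} r → Layer q (n * 9 + r) ≡ Layer (n + q) r
Layer-+ zero        r = refl
Layer-+ (suc n) {q} r = trans (Layer-+ n r) (cong (λ m → Layer m r) (+-suc n q))

-- Residue class 8 is empty too, so no adjacent pair straddles a multiple of 9.
adjacent : ∀ {q} m → Layer q m → Layer q (suc m) → ∃ λ n → m ≡ n * 9
adjacent 0 l l′ = 0 , refl
adjacent (suc (suc (suc (suc (suc (suc (suc (suc (suc m))))))))) l l′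
  with n , m≡ ← adjacent m l l′ = suc n , cong (9 +_) m≡

module Model where
  T : ℕ → Set
  T = Layer 0

  T≡Layer : ∀ n r → T (n * 9 + r) ≡ Layer n r
  T≡Layer n r = trans (Layer-+ n r) (cong (λ m → Layer m r) (+-identityʳ n))

  T⇒Layer : ∀ n r → T (n * 9 + r) → Layer n r
  T⇒Layer n r = subst (λ A → A) (T≡Layer n r)

  Layer⇒T : ∀ n r → Layer n r → T (n * 9 + r)
  Layer⇒T n r = subst (λ A → A) (sym (T≡Layer n r))

  model : Interpretation
  model = record
    { P          = λ x → ∃ λ m → x ≃ℝ fromℕ m × T m
    ; P-respects = λ {x} {y} x≃y (m , x≃m , t) →
        m , ≃-trans {y} {x} {fromℕ m} (≃-sym {x} {y} x≃y) x≃m , t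
    }
  open Interpretation model

  P⇔T : ∀ m → P (fromℕ m) ⇔ T m
  P⇔T m = mk⇔ (λ (n , m≃n , t) → subst T (sym (fromℕ-injective {m} {n} m≃n)) t)
              (λ t → m , ≃-refl (fromℕ m) , t)

  -- `P` holds only at natural numbers, so the guard cuts the real variables down to multiples of 9.
  marked : ∀ x → P x → P (x +ℝ 1ℝ) → ∃ λ n → x ≃ℝ fromℕ (n * 9)
  marked x (m , x≃m , t) p =
    proj₁ nine∣m , ≃-trans {x} {fromℕ m} {fromℕ (proj₁ nine∣m * 9)} x≃m (fromℕ-cong (proj₂ nine∣m))
    where
    x+1≃m+1 : x +ℝ 1ℝ ≃ℝ fromℕ (m + 1)
    x+1≃m+1 = ⟦⟧-fromℕ (var zero ⊕ 𝟏) {x ∷ []} {λ _ → m} λ { zero → x≃m }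
    t′ : T (suc m)
    t′ = subst T (+-comm m 1)
      (to (P⇔T (m + 1)) (P-respects {x +ℝ 1ℝ} {fromℕ (m + 1)} x+1≃m+1 p))
    nine∣m : ∃ λ n → m ≡ n * 9
    nine∣m = adjacent m t t′

  power : ∀ {n} → T (n * 9 + 3) → ∃ λ e → n ≡ 2 ^ e
  power {n} = T⇒Layer n 3

  power+ : ∀ {n} → T (n * 9 + 5) → ∃ λ e → n ≡ 2 ^ e + e
  power+ {n} = T⇒Layer n 5

  HoldsClause-T : ∀ (c : Clause k) ν → HoldsClause Derivable c ν →
                  HoldsClause (λ u → T (u * 9 + 7)) c ν
  HoldsClause-T absurd   ν h   = h
  HoldsClause-T (fact p) ν h   = Layer⇒T (value p ν) 7 h
  HoldsClause-T (p ⟶ c)  ν h t = HoldsClause-T c ν (h (T⇒Layer (value p ν) 7 t))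

  formula-holds : ∀ (r : Rule n) α → HoldsClause Derivable (body r) (α ∘ variables r) →
                  Holdsℕ T (formula r) (λ i → α i * 9)
  formula-holds r α h = clause-intro {α = α} (λ _ → refl) {T} power power+ (body r) (slotVariables r)
    (HoldsClause-T (body r) _ h)

  arithmetic-holds : ∀ (α : Fin (2 + n) → ℕ) → Holdsℕ T arithmetic (λ i → α i * 9)
  arithmetic-holds α =
    -- Remainders 9 and 10 are the residues 0 and 1 over the next quotient.
    ( Layer⇒T s 9 tt
    , subst T (sym (+-assoc (s * 9) 9 1)) (Layer⇒T s 10 tt) ) ,
    ( (0 , refl) , (0 , refl) ) ,
    λ (t₀ , t₁) → step (power (subst (λ u → T (u + 3)) (·9-sum d s) t₀))
                       (power+ (subst (λ u → T (u + 5)) (·9-sum₂ d s) t₁))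
    where
    s d : ℕ
    s = α zero
    d = α (suc zero)
    step : (∃ λ m → d + s ≡ 2 ^ m) → (∃ λ n → d + s + s ≡ 2 ^ n + n) →
           T (d * 9 + s * 9 + (d * 9 + s * 9) + 3) ×
           T (d * 9 + s * 9 + (d * 9 + s * 9) + s * 9 + 9 + 5)
    step (m , eq) (n , eq′) =
      subst (λ u → T (u + 3)) (sym (·9-double d s))
        (Layer⇒T (2 * (d + s)) 3 (suc m , cong (2 *_) eq)) ,
      subst (λ u → T (u + 5)) (sym (·9-double-suc d s))
        (Layer⇒T (2 * (d + s) + suc s) 5
          (suc m , cong₂ _+_ (cong (2 *_) eq) (cong suc s≡m)))
      where
      -- The premises supply two unrelated exponents; `x₀` is shown to be the exponent of the power
      -- `d + s`.
      s≡m : s ≡ m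
      s≡m = exponent-unique {m} {n} (subst (s ≤_) eq (m≤n+m s d)) (trans (cong (_+ s) (sym eq)) eq′)

  -- Real assignments that violate the guard satisfy the implication vacuously; the others agree
  -- with a natural assignment scaled by 9, where the clauses can be checked over the natural
  -- numbers.
  satisfied : (rs : List (Rule (2 + n))) (goal : Rule (2 + n)) (e : ℕ) →
              All (Closed Derivable) rs →
              (∀ α → α zero ≡ e → HoldsClause Derivable (body goal) (α ∘ variables goal)) →
              Holds model (sentence rs goal e) []
  satisfied {n} rs goal e closed goal-holds = close⁺ model (matrix (sentenceMatrix rs goal e)) holds
    where
    module _ (ρ : Vec ℝ (2 + n)) (guarded : HoldsQF model ⌊ guard ⌋ ρ) where
      integral : ∀ i → ∃ λ m → lookup ρ i ≃ℝ fromℕ (m * 9)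
      integral i = marked (lookup ρ i) (proj₁ mark) (proj₂ mark)
        where
        mark : HoldsQF model ⌊ marks i ⌋ ρ
        mark = conjunction⁻ model marks {ρ} guarded i

      α : Fin (2 + n) → ℕ
      α i = proj₁ (integral i)

      transfer : ∀ φ → HoldsQF model ⌊ φ ⌋ ρ ⇔ Holdsℕ T φ (λ i → α i * 9)
      transfer φ = Holds⇔Holdsℕ model P⇔T φ (λ i → proj₂ (integral i))

    holds : ∀ ρ → HoldsQF model (sentenceMatrix rs goal e) ρ
    holds ρ = ((0 , ≃-refl 0ℝ , tt) , (1 , fromℕ-1 , tt)) , λ guarded →
      from (transfer ρ guarded (arithmetic ∧′ formulas rs))
        (arithmetic-holds (α ρ guarded) ,
         formulas⁺ (All.map (λ {r} r-closed → formula-holds r (α ρ guarded) (r-closed _)) closed)) ,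
      λ x₀≐e → from (transfer ρ guarded (formula goal))
        (formula-holds goal (α ρ guarded) (goal-holds (α ρ guarded)
          (*-cancelʳ-≡ (α ρ guarded zero) e 9
            (trans (to (transfer ρ guarded (x₀ ≐′ multiple e)) x₀≐e) (⟦multiple⟧ e)))))

-- Computability of the codes

constant : ℕ → Recursive n
constant zero    = zeroF
constant (suc c) = comp sucF (constant c ∷ [])

constant-↦ : ∀ c {xs : Vec ℕ n} → constant c [ xs ]↦ c
constant-↦ zero    = zero-↦
constant-↦ (suc c) = comp-↦ (constant-↦ c ∷ []) suc-↦

double : Recursive 1
double = prec zeroF (comp sucF (comp sucF (proj (suc zero) ∷ []) ∷ []))

double-↦ : ∀ x → double [ x ∷ [] ]↦ 2 * x
double-↦ zero    = prec-zero-↦ zero-↦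
double-↦ (suc x) = subst (double [ suc x ∷ [] ]↦_) (sym (*-suc 2 x))
  (prec-suc-↦ (double-↦ x) (comp-↦ (comp-↦ (proj-↦ ∷ []) suc-↦ ∷ []) suc-↦))

-- Starts from the odd number `suc (2 * b)` and doubles it `a` times.
pairing : Recursive 2
pairing = prec (comp sucF (double ∷ [])) (comp double (proj (suc zero) ∷ []))

pairing-↦ : ∀ a b → pairing [ a ∷ b ∷ [] ]↦ ⟨ a , b ⟩
pairing-↦ zero    b = subst (pairing [ zero ∷ b ∷ [] ]↦_) (sym (*-identityˡ (suc (2 * b))))
  (prec-zero-↦ (comp-↦ (double-↦ b ∷ []) suc-↦))
pairing-↦ (suc a) b = subst (pairing [ suc a ∷ b ∷ [] ]↦_) (sym (*-assoc 2 (2 ^ a) (suc (2 * b))))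
  (prec-suc-↦ (pairing-↦ a b) (comp-↦ (proj-↦ ∷ []) (double-↦ ⟨ a , b ⟩)))

Computable : (ℕ → ℕ) → Set
Computable f = Σ (Recursive 1) λ r → ∀ x → r [ x ∷ [] ]↦ f x

computable-const : ∀ c → Computable λ _ → c
computable-const c = constant c , λ _ → constant-↦ c

computable-pair : ∀ {f g} → Computable f → Computable g → Computable λ x → ⟨ f x , g x ⟩
computable-pair (r , r↦) (s , s↦) =
  comp pairing (r ∷ s ∷ []) , λ x → comp-↦ (r↦ x ∷ s↦ x ∷ []) (pairing-↦ _ _)

computable-iterate : ∀ {f g} → Computable g → (∀ x → f (suc x) ≡ g (f x)) → Computable f
computable-iterate {f} (s , s↦) f-suc = r , r↦
  where
  r : Recursive 1
  r = prec (constant (f 0)) (comp s (proj (suc zero) ∷ []))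
  r↦ : ∀ x → r [ x ∷ [] ]↦ f x
  r↦ zero    = prec-zero-↦ (constant-↦ (f 0))
  r↦ (suc x) = prec-suc-↦ (r↦ x)
    (comp-↦ (proj-↦ ∷ []) (subst (s [ f x ∷ [] ]↦_) (sym (f-suc x)) (s↦ (f x))))

computable-id : Computable λ x → x
computable-id = proj zero , λ _ → proj-↦

-- Adding the fixed summand acts on codes by a fixed computable map, where 3 is the tag of `_⊕_`, so
-- the codes arise by primitive recursion.
computable-⊕-iterate : ∀ (t : ℕ → Term n) (s : Term n) → (∀ e → t (suc e) ≡ t e ⊕ s) →
                      Computable λ e → codeTerm (t e)
computable-⊕-iterate t s t-suc = computable-iterate
  (computable-pair (computable-const 3) (computable-pair computable-id (computable-const (codeTerm s))))
  (λ e → cong codeTerm (t-suc e))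

multiple-computable : Computable λ e → codeTerm (multiple {n} e)
multiple-computable = computable-⊕-iterate multiple (numeral 9) λ _ → refl

computable-codeQF : ∀ (φ : ℕ → QuantifierFree n) t f → (∀ e → nodeQF (φ e) ≡ (t , f e)) →
                    Computable f → Computable λ e → codeQF (φ e)
computable-codeQF φ t f node≡ f-computable
  with r , r↦ ← computable-pair (computable-const t) f-computable =
  r , λ e → subst (r [ e ∷ [] ]↦_) (cong (uncurry ⟨_,_⟩) (sym (node≡ e))) (r↦ e)

module _ (φ ψ : ℕ → QuantifierFree n)
         (φ-computable : Computable λ e → codeQF (φ e))
         (ψ-computable : Computable λ e → codeQF (ψ e)) where

  private
    codes : ℕ → ℕ
    codes e = ⟨ codeQF (φ e) , codeQF (ψ e) ⟩

    codes-computable : Computable codes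
    codes-computable = computable-pair φ-computable ψ-computable

  computable-∧ : Computable λ e → codeQF (φ e ∧ ψ e)
  computable-∧ = computable-codeQF (λ e → φ e ∧ ψ e) 5 codes (λ _ → refl) codes-computable

  computable-⇒ : Computable λ e → codeQF (φ e ⇒ ψ e)
  computable-⇒ = computable-codeQF (λ e → φ e ⇒ ψ e) 7 codes (λ _ → refl) codes-computable

computable-≐ : ∀ (s t : ℕ → Term n) → Computable (λ e → codeTerm (s e)) →
               Computable (λ e → codeTerm (t e)) → Computable λ e → codeQF (s e ≐ t e)
computable-≐ s t s-computable t-computable =
  computable-codeQF (λ e → s e ≐ t e) 0 (λ e → ⟨ codeTerm (s e) , codeTerm (t e) ⟩) (λ _ → refl)
    (computable-pair s-computable t-computable)

computable-close : (φ : ℕ → Universal n) → Computable (λ e → code (φ e)) →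
                   Computable λ e → code (close (φ e))
computable-close {zero}  φ φ-computable = φ-computable
computable-close {suc n} φ φ-computable =
  computable-close (λ e → forall′ (φ e)) (computable-pair (computable-const 1) φ-computable)

-- The formulas are variables because the codes of the concrete ones are astronomical numbers
-- that must never be evaluated.
computable-skeleton : ∀ (φ ψ χ ω : QuantifierFree n) s (t : ℕ → Term n) →
  Computable (λ e → codeTerm (t e)) →
  Computable λ e → code (close (matrix (φ ∧ (ψ ⇒ χ ∧ (s ≐ t e ⇒ ω)))))
computable-skeleton φ ψ χ ω s t t-computable =
  computable-close (λ e → matrix (φ ∧ (ψ ⇒ χ ∧ (s ≐ t e ⇒ ω))))
    (computable-pair (computable-const 0)
      (computable-∧ (λ _ → φ) (λ e → ψ ⇒ χ ∧ (s ≐ t e ⇒ ω)) (constantly φ)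
        (computable-⇒ (λ _ → ψ) (λ e → χ ∧ (s ≐ t e ⇒ ω)) (constantly ψ)
          (computable-∧ (λ _ → χ) (λ e → s ≐ t e ⇒ ω) (constantly χ)
            (computable-⇒ (λ e → s ≐ t e) (λ _ → ω)
              (computable-≐ (λ _ → s) t (computable-const (codeTerm s)) t-computable)
              (constantly ω))))))
  where
  constantly : ∀ θ → Computable λ _ → codeQF θ
  constantly θ = computable-const (codeQF θ)

sentence-computable : ∀ (rs : List (Rule (2 + n))) goal →
                      Computable λ e → code (sentence rs goal e)
sentence-computable rs goal =
  computable-skeleton ⌊ origin ⌋ ⌊ guard ⌋ ⌊ arithmetic ∧′ formulas rs ⌋ ⌊ formula goal ⌋
    x₀ multiple multiple-computable

-- The diagonal argument

-- refutation b says that the program 𝑣 0 does not return b on its own code.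
refutation : ℕ → Rule V
refutation b = rule {arity = 1} (⟪ 𝑣 0 , 𝑣 0 ⸴ lit 0 , lit b ⟫ ⟶ absurd)

sentence-unsatisfiable : ∀ {b e} → e ⊢ pair e 0 ⇓ b →
                         Unsatisfiable (sentence evalRules (refutation b) e)
sentence-unsatisfiable {b} {e} p (I , model) =
  goal-holds (λ _ → e) refl (⇓-least closed p)
  where open Refutation I evalRules (refutation b) e model

sentence-satisfiable : ∀ {b e} → ¬ (e ⊢ pair e 0 ⇓ b) →
                       Satisfiable (sentence evalRules (refutation b) e)
sentence-satisfiable {b} {e} ¬p =
  Model.model , Model.satisfied evalRules (refutation b) e Derivable-closed
    λ α α₀≡e d → ¬p (subst (λ x → x ⊢ pair x 0 ⇓ b) α₀≡e (derivation d))

-- The program applies `f` after `h` and is run on its own number; `pair e 0` is that number as a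
-- tuple of length one.
diagonalisation : ∀ {h} (f : Recursive 1) → Computable h → ∃ λ e →
                  ∀ {y} → f [ h e ∷ [] ]↦ y → e ⊢ pair e 0 ⇓ y
diagonalisation f (r , r↦) =
  index (comp f (r ∷ [])) , λ f↦ → index-⇓ (comp-↦ (r↦ _ ∷ []) f↦)

module _ (φ : ℕ → ℕ → UniversalSentence)
         (φ-computable : ∀ b → Computable λ e → code (φ b e))
         (unsatisfiable : ∀ {b e} → e ⊢ pair e 0 ⇓ b → Unsatisfiable (φ b e))
         (satisfiable : ∀ {b e} → ¬ (e ⊢ pair e 0 ⇓ b) → Satisfiable (φ b e)) where

  -- With `b = 1`, the answer "satisfiable" makes the program return 1, which refutes the sentence;
  -- the answer 0 makes it return 0, hence not 1, which satisfies the sentence.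
  satisfiability-undecidable : Undecidable {A = UniversalSentence} code Satisfiable
  satisfiability-undecidable (f , decides)
    with e , run ← diagonalisation f (φ-computable 1) | decides (φ 1 e)
  ... | inj₁ (f↦1 , sat)  = unsatisfiable (run f↦1) sat
  ... | inj₂ (f↦0 , ¬sat) = ¬sat (satisfiable λ p → 0≢1+n (⇓-functional (run f↦0) p))

  -- The roles of the answers are exchanged, so the forbidden output is now 0.
  unsatisfiability-undecidable : Undecidable {A = UniversalSentence} code Unsatisfiable
  unsatisfiability-undecidable (f , decides)
    with e , run ← diagonalisation f (φ-computable 0) | decides (φ 0 e)
  ... | inj₁ (f↦1 , unsat)  = unsat (satisfiable λ p → 0≢1+n (⇓-functional p (run f↦1)))
  ... | inj₂ (f↦0 , ¬unsat) = ¬unsat (unsatisfiable (run f↦0))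

module _ (rs : List (Rule (2 + n))) (goal : ℕ → Rule (2 + n))
         (unsatisfiable : ∀ {b e} → e ⊢ pair e 0 ⇓ b → Unsatisfiable (sentence rs (goal b) e))
         (satisfiable : ∀ {b e} → ¬ (e ⊢ pair e 0 ⇓ b) → Satisfiable (sentence rs (goal b) e))
         where

  sentences-undecidable : Undecidable {A = UniversalSentence} code Satisfiable ×
                          Undecidable {A = UniversalSentence} code Unsatisfiable
  sentences-undecidable =
    satisfiability-undecidable φ φ-computable unsatisfiable satisfiable ,
    unsatisfiability-undecidable φ φ-computable unsatisfiable satisfiable
    where
    φ : ℕ → ℕ → UniversalSentence
    φ b = sentence rs (goal b)
    φ-computable : ∀ b → Computable λ e → code (φ b e)
    φ-computable b = sentence-computable rs (goal b)

theorem5 : Undecidable {A = UniversalSentence} code Satisfiable × Undecidable {A = UniversalSentence} code Unsatisfiable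
theorem5 = sentences-undecidable evalRules refutation sentence-unsatisfiable sentence-satisfiable
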